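{- For every integer $k\geq 0$, the polynomial $H_k(x)$ is unimodal.
   Context: $B_n$ is the set of signed permutations of $[n]$ (permutations with possible minus signs on entries); $\mathrm{des}_B(\pi)$ is the number of $i\in\{0,\dots,n-1\}$ with $\pi_i>\pi_{i+1}$ where $\pi_0=0$; $B_n(t)=\sum_{\pi\in B_n}t^{\mathrm{des}_B(\pi)}$ is the type $B$ Eulerian polynomial ($B_0=1$). Define \[ H_k(x)=\sum_{l=0}^{k}B_{k-l}(x^{2k+2})(x^{2k+2}-1)^l\sum_{s=l}^{k}\binom{s}{l}x^{2k+1-s}+\sum_{l=0}^{k}B_{k-l}(x^{ -2k-2})(x^{ -2k-2}-1)^l\sum_{s=l}^{k}\binom{s}{l}x^{2(k+1)^2+s}. \] A polynomial is unimodal if its coefficient sequence $s_0,s_1,\dots,s_m$ satisfies $s_0\leq\cdots\leq s_t\geq s_{t+1}\geq\cdots\geq s_m$ for some $t$. -}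

module Defs where

open import Data.Nat as ℕ using (ℕ; zero; suc)
open import Data.Nat.Combinatorics using (_C_)
open import Data.Integer as ℤ using (ℤ; +_; -_; ∣_∣)
open import Data.Bool using (Bool; true; false; _∧_; not; if_then_else_)
open import Data.List using (List; []; _∷_; map; concatMap; filter; length; _++_; foldr; upTo)
open import Data.Product using (_×_; _,_; Σ; ∃; proj₁; proj₂)
open import Relation.Nullary.Decidable using (⌊_⌋)

-- [a .. b] as a list of naturals (empty if b < a)
range : ℕ → ℕ → List ℕ
range a b = map (a ℕ.+_) (upTo (suc b ℕ.∸ a))

-- Signed permutations of [n]
-- A signed permutation is a word π₁ … πₙ with entries in {±1,…,±n}
-- whose absolute values |π₁|,…,|πₙ| are pairwise distinct
-- (so they form a permutation of [n]).

words : {A : Set} → List A → ℕ → List (List A)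
words alph zero    = [] ∷ []
words alph (suc n) = concatMap (λ a → map (a ∷_) (words alph n)) alph

signedLetters : ℕ → List ℤ
signedLetters n = concatMap (λ i → (+ i) ∷ (- (+ i)) ∷ []) (range 1 n)

memℕ : ℕ → List ℕ → Bool
memℕ x []       = false
memℕ x (y ∷ ys) = ⌊ x ℕ.≟ y ⌋ Data.Bool.∨ memℕ x ys

distinctℕ : List ℕ → Bool
distinctℕ []       = true
distinctℕ (x ∷ xs) = not (memℕ x xs) ∧ distinctℕ xs

isSignedPerm : List ℤ → Bool
isSignedPerm w = distinctℕ (map ∣_∣ w)

signedPerms : ℕ → List (List ℤ)
signedPerms n = filter (λ w → isSignedPerm w Data.Bool.≟ true) (words (signedLetters n) n)

-- des_B π = #{ i ∈ {0,…,n-1} : π_i > π_{i+1} } with π₀ = 0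
desFrom : ℤ → List ℤ → ℕ
desFrom prev []       = 0
desFrom prev (a ∷ as) =
  (if ⌊ a ℤ.<? prev ⌋ then 1 else 0) ℕ.+ desFrom a as

desB : List ℤ → ℕ
desB π = desFrom (+ 0) π

-- Laurent polynomials in x with integer coefficients, represented as
-- finite formal sums of monomials  c · x^e  (pairs (c , e)).

Laurent : Set
Laurent = List (ℤ × ℤ)

infixl 7 _⊗_
infixl 6 _⊕_ _⊖_

mono : ℤ → ℤ → Laurent
mono c e = (c , e) ∷ []

constL : ℤ → Laurent
constL c = mono c (+ 0)

_⊕_ : Laurent → Laurent → Laurent
p ⊕ q = p ++ q

_⊗_ : Laurent → Laurent → Laurent
p ⊗ q = concatMap (λ { (c , e) → map (λ { (d , f) → (c ℤ.* d , e ℤ.+ f) }) q }) p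

_⊖_ : Laurent → Laurent → Laurent
p ⊖ q = p ⊕ map (λ { (c , e) → (ℤ.- c , e) }) q

powL : Laurent → ℕ → Laurent
powL p zero    = constL (+ 1)
powL p (suc n) = p ⊗ powL p n

substPow : ℤ → Laurent → Laurent
substPow m p = map (λ { (c , e) → (c , e ℤ.* m) }) p

ΣL : List ℕ → (ℕ → Laurent) → Laurent
ΣL is f = foldr (λ i acc → f i ⊕ acc) [] is

coeff : Laurent → ℤ → ℤ
coeff p e = foldr (λ { (c , f) acc → (if ⌊ f ℤ.≟ e ⌋ then c else + 0) ℤ.+ acc }) (+ 0) p

-- degree: largest exponent carrying a nonzero coefficient (0 for the zero polynomial)
degree : Laurent → ℤ
degree p = foldr (λ { (c , f) acc →
                     if not ⌊ coeff p f ℤ.≟ + 0 ⌋ then f ℤ.⊔ acc else acc }) (+ 0) p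

eulerianB : ℕ → Laurent
eulerianB n = map (λ π → (+ 1 , + desB π)) (signedPerms n)

Hk : ℕ → Laurent
Hk k =
    ΣL (range 0 k) (λ l →
        substPow (+ m) (eulerianB (k ℕ.∸ l))
      ⊗ powL (mono (+ 1) (+ m) ⊖ constL (+ 1)) l
      ⊗ ΣL (range l k) (λ s → mono (+ (s C l)) (+ (2 ℕ.* k ℕ.+ 1) ℤ.- + s)))
  ⊕ ΣL (range 0 k) (λ l →
        substPow (- (+ m)) (eulerianB (k ℕ.∸ l))
      ⊗ powL (mono (+ 1) (- (+ m)) ⊖ constL (+ 1)) l
      ⊗ ΣL (range l k) (λ s → mono (+ (s C l)) (+ (2 ℕ.* ((k ℕ.+ 1) ℕ.* (k ℕ.+ 1)) ℕ.+ s))))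
  where
    m : ℕ
    m = 2 ℕ.* k ℕ.+ 2

Unimodal : Laurent → Set
Unimodal p =
  ∃ λ (t : ℕ) →
      (+ t ℤ.≤ degree p)
    × (∀ (i j : ℕ) → i ℕ.≤ j → j ℕ.≤ t → coeff p (+ i) ℤ.≤ coeff p (+ j))
    × (∀ (i j : ℕ) → t ℕ.≤ i → i ℕ.≤ j → + j ℤ.≤ degree p → coeff p (+ j) ℤ.≤ coeff p (+ i))

{-# OPTIONS --safe #-}
module Submission where

-- Let U n s be the descent generating function of the signed words on n letters that
-- follow a positive letter exceeding exactly s of the n absolute values, so that
-- U n 0 = Bₙ(t).  Comparing two neighbouring starting letters gives
-- U (n+1) (s+1) = U (n+1) s + (t - 1) U n s, hence U k s = ∑ₗ C(s,l) B_{k-l}(t) (t-1)ˡ.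
-- Writing u k s j for the coefficient of tʲ in U k s, the coefficients of Hₖ read in
-- blocks of length k+1: the even block 2j is u k 0 (k+1-j), …, u k k (k+1-j), and the
-- odd block 2j+1 is u k k j, …, u k 0 j.  Neighbouring blocks agree where they meet:
-- negating all letters makes U k 0 palindromic of degree k, and since the first letter
-- after +∞ is always a descent and after -∞ never, U k k is palindromic of degree k+1.
-- Inside a block the recurrence turns monotonicity in s at level k into monotonicity in
-- j at level k-1, which follows from going around the blocks at level k-1.

open import Defs
open import Data.Bool using (Bool; true; false; if_then_else_; not; _∨_)
import Data.Bool as Bool
open import Data.Empty using (⊥-elim)
open import Data.Integer as ℤ using (ℤ; +_; -[1+_]; -_; _+_; _*_; _-_; _≤_; ∣_∣; 0ℤ; 1ℤ)
import Data.Integer.Properties as ℤ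
open import Algebra.Properties.AbelianGroup ℤ.+-0-abelianGroup using (∙-cancelˡ)
open import Data.Integer.Tactic.RingSolver using (solve-∀)
open import Data.List using (List; []; _∷_; map; concatMap; filter; length; _++_; foldr; upTo; applyUpTo)
open import Data.List.Properties using (map-upTo; length-map; length-upTo; filter-all; filter-accept; filter-reject)
open import Data.List.Membership.Propositional using (_∈_)
open import Data.List.Membership.Propositional.Properties using (∈-upTo⁻)
open import Data.List.Relation.Unary.All as All using (All; []; _∷_)
import Data.List.Relation.Unary.All.Properties as All
open import Data.List.Relation.Unary.AllPairs using (AllPairs; []; _∷_)
import Data.List.Relation.Unary.AllPairs.Properties as AllPairs
open import Data.List.Relation.Unary.Any using (Any; here; there)
open import Data.Nat using (ℕ)
open import Data.Nat as ℕ using (zero; suc; _<ᵇ_; s≤s; z≤n)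
import Data.Nat.Properties as ℕ
open import Data.Nat.Combinatorics using (_C_; nCn≡1; nCk≡nC[n∸k]; k>n⇒nCk≡0; nCk+nC[k+1]≡[n+1]C[k+1])
open import Data.Nat.DivMod using (_/_; _%_; m≡m%n+[m/n]*n; m%n<n)
open import Data.Nat.Tactic.RingSolver using () renaming (solve-∀ to solveℕ-∀)
open import Data.Product using (_×_; _,_; proj₁; proj₂; ∃)
open import Data.Sum using (_⊎_; inj₁; inj₂)
open import Function using (_∘_)
open import Relation.Binary.PropositionalEquality
open import Relation.Nullary using (Dec; yes; no; ¬_; does)
open import Relation.Nullary.Decidable using (⌊_⌋; isYes≗does; dec-true; dec-false; ¬?)
open import Relation.Unary using (Decidable)

-- Finite sums

private variable
  A B : Set

∑ : List A → (A → ℤ) → ℤ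
∑ []       f = 0ℤ
∑ (x ∷ xs) f = f x + ∑ xs f

∑-cong-∈ : ∀ (xs : List A) {f g : A → ℤ} → (∀ {x} → x ∈ xs → f x ≡ g x) → ∑ xs f ≡ ∑ xs g
∑-cong-∈ []       eq = refl
∑-cong-∈ (x ∷ xs) eq = cong₂ _+_ (eq (here refl)) (∑-cong-∈ xs (eq ∘ there))

∑-cong : ∀ (xs : List A) {f g : A → ℤ} → (∀ x → f x ≡ g x) → ∑ xs f ≡ ∑ xs g
∑-cong xs eq = ∑-cong-∈ xs (λ {x} _ → eq x)

∑-zero : ∀ (xs : List A) → ∑ xs (λ _ → 0ℤ) ≡ 0ℤ
∑-zero []       = refl
∑-zero (x ∷ xs) = trans (ℤ.+-identityˡ _) (∑-zero xs)

∑-++ : ∀ (xs ys : List A) f → ∑ (xs ++ ys) f ≡ ∑ xs f + ∑ ys f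
∑-++ []       ys f = sym (ℤ.+-identityˡ _)
∑-++ (x ∷ xs) ys f = trans (cong (_+_ (f x)) (∑-++ xs ys f)) (sym (ℤ.+-assoc (f x) (∑ xs f) (∑ ys f)))

∑-map : ∀ (g : A → B) xs f → ∑ (map g xs) f ≡ ∑ xs (f ∘ g)
∑-map g []       f = refl
∑-map g (x ∷ xs) f = cong (_+_ (f (g x))) (∑-map g xs f)

∑-concatMap : ∀ (g : A → List B) xs f → ∑ (concatMap g xs) f ≡ ∑ xs (λ x → ∑ (g x) f)
∑-concatMap g []       f = refl
∑-concatMap g (x ∷ xs) f =
  trans (∑-++ (g x) (concatMap g xs) f) (cong (_+_ (∑ (g x) f)) (∑-concatMap g xs f))

∑-+ : ∀ (xs : List A) f g → ∑ xs (λ x → f x + g x) ≡ ∑ xs f + ∑ xs g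
∑-+ []       f g = refl
∑-+ (x ∷ xs) f g = trans (cong (_+_ (f x + g x)) (∑-+ xs f g)) (lemma (f x) (g x) (∑ xs f) (∑ xs g))
  where
  lemma : ∀ a b c d → (a + b) + (c + d) ≡ (a + c) + (b + d)
  lemma = solve-∀

[a-b]+[c-d] : ∀ a b c d → (a - b) + (c - d) ≡ (a + c) - (b + d)
[a-b]+[c-d] = solve-∀

∑-sub : ∀ (xs : List A) f g → ∑ xs (λ x → f x - g x) ≡ ∑ xs f - ∑ xs g
∑-sub []       f g = refl
∑-sub (x ∷ xs) f g = trans (cong (_+_ (f x - g x)) (∑-sub xs f g)) ([a-b]+[c-d] (f x) (g x) (∑ xs f) (∑ xs g))
∑-*ˡ : ∀ c (xs : List A) f → ∑ xs (λ x → c * f x) ≡ c * ∑ xs f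
∑-*ˡ c []       f = sym (ℤ.*-zeroʳ c)
∑-*ˡ c (x ∷ xs) f = trans (cong (_+_ (c * f x)) (∑-*ˡ c xs f)) (sym (ℤ.*-distribˡ-+ c (f x) (∑ xs f)))

∑-swap : ∀ (xs : List A) (ys : List B) (f : A → B → ℤ) →
         ∑ xs (λ x → ∑ ys (f x)) ≡ ∑ ys (λ y → ∑ xs (λ x → f x y))
∑-swap []       ys f = sym (∑-zero ys)
∑-swap (x ∷ xs) ys f =
  trans (cong (_+_ (∑ ys (f x))) (∑-swap xs ys f)) (sym (∑-+ ys (f x) (λ y → ∑ xs (λ x → f x y))))

∑-filter : ∀ {P : A → Set} (P? : Decidable P) xs f →
           ∑ (filter P? xs) f ≡ ∑ xs (λ x → if does (P? x) then f x else 0ℤ)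
∑-filter P? []       f = refl
∑-filter P? (x ∷ xs) f with does (P? x)
... | true  = cong (_+_ (f x)) (∑-filter P? xs f)
... | false = trans (∑-filter P? xs f) (sym (ℤ.+-identityˡ _))

∑-applyUpTo : ∀ (g : ℕ → A) n f → ∑ (applyUpTo g n) f ≡ ∑ (upTo n) (f ∘ g)
∑-applyUpTo g n f = trans (cong (λ xs → ∑ xs f) (sym (map-upTo g n))) (∑-map g (upTo n) f)

∑-upTo-suc : ∀ n f → ∑ (upTo (suc n)) f ≡ f 0 + ∑ (upTo n) (f ∘ suc)
∑-upTo-suc n f = cong (_+_ (f 0)) (∑-applyUpTo suc n f)

∑-range : ∀ a b f → ∑ (range a b) f ≡ ∑ (upTo (suc b ℕ.∸ a)) (f ∘ (a ℕ.+_))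
∑-range a b f = ∑-map (a ℕ.+_) (upTo (suc b ℕ.∸ a)) f

∑-upTo-drop : ∀ a n f → (∀ i → i ℕ.< a → f i ≡ 0ℤ) → a ℕ.≤ n →
              ∑ (upTo n) f ≡ ∑ (upTo (n ℕ.∸ a)) (f ∘ (a ℕ.+_))
∑-upTo-drop zero    n       f f≡0 a≤n       = refl
∑-upTo-drop (suc a) (suc n) f f≡0 (s≤s a≤n) = begin
  ∑ (upTo (suc n)) f                          ≡⟨ ∑-upTo-suc n f ⟩
  f 0 + ∑ (upTo n) (f ∘ suc)                  ≡⟨ cong (_+ ∑ (upTo n) (f ∘ suc)) (f≡0 0 (s≤s z≤n)) ⟩
  0ℤ + ∑ (upTo n) (f ∘ suc)                   ≡⟨ ℤ.+-identityˡ _ ⟩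
  ∑ (upTo n) (f ∘ suc)                        ≡⟨ ∑-upTo-drop a n (f ∘ suc) (λ i i<a → f≡0 (suc i) (s≤s i<a)) a≤n ⟩
  ∑ (upTo (n ℕ.∸ a)) (f ∘ suc ∘ (a ℕ.+_))     ∎
  where open ≡-Reasoning

∑-upTo-zero : ∀ n f → (∀ i → i ℕ.< n → f i ≡ 0ℤ) → ∑ (upTo n) f ≡ 0ℤ
∑-upTo-zero n f f≡0 = trans (∑-cong-∈ (upTo n) (λ {i} i∈ → f≡0 i (∈-upTo⁻ i∈))) (∑-zero (upTo n))

∑-upTo-single : ∀ n f i → i ℕ.< n → (∀ j → j ℕ.< n → j ≢ i → f j ≡ 0ℤ) → ∑ (upTo n) f ≡ f i
∑-upTo-single (suc n) f zero i<n f≡0 = begin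
  ∑ (upTo (suc n)) f           ≡⟨ ∑-upTo-suc n f ⟩
  f 0 + ∑ (upTo n) (f ∘ suc)   ≡⟨ cong (_+_ (f 0)) (∑-upTo-zero n (f ∘ suc) (λ j j<n → f≡0 (suc j) (s≤s j<n) (λ ()))) ⟩
  f 0 + 0ℤ                     ≡⟨ ℤ.+-identityʳ (f 0) ⟩
  f 0                          ∎
  where open ≡-Reasoning
∑-upTo-single (suc n) f (suc i) (s≤s i<n) f≡0 = begin
  ∑ (upTo (suc n)) f           ≡⟨ ∑-upTo-suc n f ⟩
  f 0 + ∑ (upTo n) (f ∘ suc)   ≡⟨ cong (_+ ∑ (upTo n) (f ∘ suc)) (f≡0 0 (s≤s z≤n) (λ ())) ⟩
  0ℤ + ∑ (upTo n) (f ∘ suc)    ≡⟨ ℤ.+-identityˡ _ ⟩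
  ∑ (upTo n) (f ∘ suc)         ≡⟨ ∑-upTo-single n (f ∘ suc) i i<n (λ j j<n j≢i → f≡0 (suc j) (s≤s j<n) (j≢i ∘ ℕ.suc-injective)) ⟩
  f (suc i)                    ∎
  where open ≡-Reasoning

∑-nonNeg : ∀ (xs : List A) {f} → (∀ x → 0ℤ ≤ f x) → 0ℤ ≤ ∑ xs f
∑-nonNeg []       0≤f = ℤ.≤-refl
∑-nonNeg (x ∷ xs) 0≤f = ℤ.+-mono-≤ (0≤f x) (∑-nonNeg xs 0≤f)

-- The argument f stands for a polynomial evaluation: tᵈ is sent to f d.  V is the analogue
-- of U for a negative preceding letter whose absolute value exceeds s of the others; i is
-- the rank of the absolute value of the first letter.
U V : ℕ → ℕ → (ℤ → ℤ) → ℤ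
U-step V-step : ℕ → ℕ → (ℤ → ℤ) → ℕ → ℤ
U zero    s f = f 0ℤ
U (suc n) s f = ∑ (upTo (suc n)) (U-step n s f)
V zero    s f = f 0ℤ
V (suc n) s f = ∑ (upTo (suc n)) (V-step n s f)
U-step n s f i = (if i <ᵇ s then U n i (f ∘ ℤ.suc) else U n i f) + V n i (f ∘ ℤ.suc)
V-step n s f i = U n i f + (if i <ᵇ s then V n i f else V n i (f ∘ ℤ.suc))

-- Linearity, positivity and symmetries of `U` and `V`

if-cong : ∀ b {x x′ y y′ : A} → x ≡ x′ → y ≡ y′ → (if b then x else y) ≡ (if b then x′ else y′)
if-cong true  p q = p
if-cong false p q = q

U-cong : ∀ n s {f g} → (∀ d → f d ≡ g d) → U n s f ≡ U n s g
V-cong : ∀ n s {f g} → (∀ d → f d ≡ g d) → V n s f ≡ V n s g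
U-cong zero    s eq = eq 0ℤ
U-cong (suc n) s eq = ∑-cong (upTo (suc n)) λ i →
  cong₂ _+_ (if-cong (i <ᵇ s) (U-cong n i (eq ∘ ℤ.suc)) (U-cong n i eq)) (V-cong n i (eq ∘ ℤ.suc))
V-cong zero    s eq = eq 0ℤ
V-cong (suc n) s eq = ∑-cong (upTo (suc n)) λ i →
  cong₂ _+_ (U-cong n i eq) (if-cong (i <ᵇ s) (V-cong n i eq) (V-cong n i (eq ∘ ℤ.suc)))

if-sub : ∀ b (w x y z : ℤ) → (if b then w - x else y - z) ≡ (if b then w else y) - (if b then x else z)
if-sub true  w x y z = refl
if-sub false w x y z = refl

-- Both functions only add up values of the evaluation, hence are linear in it. Differences are the
-- case that expresses the factor t - 1.
U-sub : ∀ n s f g → U n s (λ d → f d - g d) ≡ U n s f - U n s g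
V-sub : ∀ n s f g → V n s (λ d → f d - g d) ≡ V n s f - V n s g
U-sub zero    s f g = refl
U-sub (suc n) s f g = trans
  (∑-cong (upTo (suc n)) λ i → trans
    (cong₂ _+_
      (trans
        (if-cong (i <ᵇ s) (U-sub n i (f ∘ ℤ.suc) (g ∘ ℤ.suc)) (U-sub n i f g))
        (if-sub (i <ᵇ s) (U n i (f ∘ ℤ.suc)) (U n i (g ∘ ℤ.suc)) (U n i f) (U n i g)))
      (V-sub n i (f ∘ ℤ.suc) (g ∘ ℤ.suc)))
    ([a-b]+[c-d]
      (if i <ᵇ s then U n i (f ∘ ℤ.suc) else U n i f)
      (if i <ᵇ s then U n i (g ∘ ℤ.suc) else U n i g)
      (V n i (f ∘ ℤ.suc)) (V n i (g ∘ ℤ.suc))))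
  (∑-sub (upTo (suc n)) (U-step n s f) (U-step n s g))
V-sub zero    s f g = refl
V-sub (suc n) s f g = trans
  (∑-cong (upTo (suc n)) λ i → trans
    (cong₂ _+_
      (U-sub n i f g)
      (trans
        (if-cong (i <ᵇ s) (V-sub n i f g) (V-sub n i (f ∘ ℤ.suc) (g ∘ ℤ.suc)))
        (if-sub (i <ᵇ s) (V n i f) (V n i g) (V n i (f ∘ ℤ.suc)) (V n i (g ∘ ℤ.suc)))))
    ([a-b]+[c-d]
      (U n i f) (U n i g)
      (if i <ᵇ s then V n i f else V n i (f ∘ ℤ.suc))
      (if i <ᵇ s then V n i g else V n i (g ∘ ℤ.suc))))
  (∑-sub (upTo (suc n)) (V-step n s f) (V-step n s g))

U-zero : ∀ n s → U n s (λ _ → 0ℤ) ≡ 0ℤ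
U-zero n s = trans (U-sub n s (λ _ → 0ℤ) (λ _ → 0ℤ)) (ℤ.+-inverseʳ (U n s (λ _ → 0ℤ)))

if-nonNeg : ∀ b {x y} → 0ℤ ≤ x → 0ℤ ≤ y → 0ℤ ≤ (if b then x else y)
if-nonNeg true  p q = p
if-nonNeg false p q = q

U-nonNeg : ∀ n s {f} → (∀ d → 0ℤ ≤ f d) → 0ℤ ≤ U n s f
V-nonNeg : ∀ n s {f} → (∀ d → 0ℤ ≤ f d) → 0ℤ ≤ V n s f
U-nonNeg zero    s p = p 0ℤ
U-nonNeg (suc n) s p = ∑-nonNeg (upTo (suc n)) λ i →
  ℤ.+-mono-≤ (if-nonNeg (i <ᵇ s) (U-nonNeg n i (p ∘ ℤ.suc)) (U-nonNeg n i p)) (V-nonNeg n i (p ∘ ℤ.suc))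
V-nonNeg zero    s p = p 0ℤ
V-nonNeg (suc n) s p = ∑-nonNeg (upTo (suc n)) λ i →
  ℤ.+-mono-≤ (U-nonNeg n i p) (if-nonNeg (i <ᵇ s) (V-nonNeg n i p) (V-nonNeg n i (p ∘ ℤ.suc)))

suc[n]-d : ∀ n d → + suc n - d ≡ ℤ.suc (+ n - d)
suc[n]-d n d = ℤ.+-assoc 1ℤ (+ n) (- d)

suc[n]-suc[d] : ∀ n d → + suc n - ℤ.suc d ≡ + n - d
suc[n]-suc[d] n d = lemma (+ n) d
  where
  lemma : ∀ n d → (1ℤ + n) - (1ℤ + d) ≡ n - d
  lemma = solve-∀

-- Negating all letters exchanges ascents and descents.
U-reflect : ∀ n s f → U n s f ≡ V n s (λ d → f (+ n - d))
V-reflect : ∀ n s f → V n s f ≡ U n s (λ d → f (+ n - d))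
U-reflect zero    s f = refl
U-reflect (suc n) s f = ∑-cong (upTo (suc n)) λ i → trans
  (cong₂ _+_
    (if-cong (i <ᵇ s)
      (trans (U-reflect n i (f ∘ ℤ.suc)) (V-cong n i λ d → cong f (sym (suc[n]-d n d))))
      (trans (U-reflect n i f) (V-cong n i λ d → cong f (sym (suc[n]-suc[d] n d)))))
    (trans (V-reflect n i (f ∘ ℤ.suc)) (U-cong n i λ d → cong f (sym (suc[n]-d n d)))))
  (ℤ.+-comm _ (U n i _))
V-reflect n s f = trans
  (V-cong n s λ d → cong f (lemma (+ n) d))
  (sym (U-reflect n s (λ d → f (+ n - d))))
  where
  lemma : ∀ n d → d ≡ n - (n - d)
  lemma = solve-∀

-- A preceding letter whose absolute value is below all others compares with every letter as 0 does,
-- whatever its sign, so both recursions unfold to the same sum.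
U₀≡V₀ : ∀ n f → U n 0 f ≡ V n 0 f
U₀≡V₀ zero    f = refl
U₀≡V₀ (suc n) f = refl

<ᵇ-true : ∀ {i s} → i ℕ.< s → (i <ᵇ s) ≡ true
<ᵇ-true {i} {s} = dec-true (i ℕ.<? s)

<ᵇ-false : ∀ {i s} → ¬ i ℕ.< s → (i <ᵇ s) ≡ false
<ᵇ-false {i} {s} = dec-false (i ℕ.<? s)

-- A first letter following +∞ is always a descent, one following -∞ never is.
Uₙ≡Vₙ∘suc : ∀ n f → U (suc n) (suc n) f ≡ V (suc n) (suc n) (f ∘ ℤ.suc)
Uₙ≡Vₙ∘suc n f = ∑-cong-∈ (upTo (suc n)) step
  where
  step : ∀ {i} → i ∈ upTo (suc n) → U-step n (suc n) f i ≡ V-step n (suc n) (f ∘ ℤ.suc) i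
  step i∈ rewrite <ᵇ-true (∈-upTo⁻ i∈) = refl

-- The two sums differ only in the summand `i = s`, whose branch switches from `b` to `a`.
∑-threshold : ∀ n s (a b c : ℕ → ℤ) → s ℕ.< n →
  ∑ (upTo n) (λ i → (if i <ᵇ suc s then a i else b i) + c i) ≡
  ∑ (upTo n) (λ i → (if i <ᵇ s then a i else b i) + c i) + (a s - b s)
∑-threshold (suc n) zero a b c s<n = begin
  ∑ (upTo (suc n)) f                            ≡⟨ ∑-upTo-suc n f ⟩
  (a 0 + c 0) + ∑ (upTo n) (g ∘ suc)            ≡⟨ lemma (a 0) (b 0) (c 0) (∑ (upTo n) (g ∘ suc)) ⟩
  (g 0 + ∑ (upTo n) (g ∘ suc)) + (a 0 - b 0)    ≡⟨ cong (_+ (a 0 - b 0)) (sym (∑-upTo-suc n g)) ⟩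
  ∑ (upTo (suc n)) g + (a 0 - b 0)              ∎
  where
  open ≡-Reasoning
  f g : ℕ → ℤ
  f i = (if i <ᵇ 1 then a i else b i) + c i
  g i = b i + c i
  lemma : ∀ a b c x → (a + c) + x ≡ ((b + c) + x) + (a - b)
  lemma = solve-∀
∑-threshold (suc n) (suc s) a b c (s≤s s<n) = begin
  ∑ (upTo (suc n)) f                          ≡⟨ ∑-upTo-suc n f ⟩
  f 0 + ∑ (upTo n) (f ∘ suc)                  ≡⟨ cong (_+_ (f 0)) (∑-threshold n s (a ∘ suc) (b ∘ suc) (c ∘ suc) s<n) ⟩
  f 0 + (∑ (upTo n) (g ∘ suc) + x)            ≡⟨ sym (ℤ.+-assoc (f 0) (∑ (upTo n) (g ∘ suc)) x) ⟩
  (g 0 + ∑ (upTo n) (g ∘ suc)) + x            ≡⟨ cong (_+ x) (sym (∑-upTo-suc n g)) ⟩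
  ∑ (upTo (suc n)) g + x                      ∎
  where
  open ≡-Reasoning
  f g : ℕ → ℤ
  f i = (if i <ᵇ suc (suc s) then a i else b i) + c i
  g i = (if i <ᵇ suc s then a i else b i) + c i
  x = a (suc s) - b (suc s)

-- Raising `s` by one turns exactly one first letter, the positive one of rank `s`, from an ascent
-- into a descent. The added difference is (t - 1) times `U n s`, as precomposition with `ℤ.suc` is
-- multiplication by t.
U-suc : ∀ n s f → s ℕ.≤ n → U (suc n) (suc s) f ≡ U (suc n) s f + (U n s (f ∘ ℤ.suc) - U n s f)
U-suc n s f s≤n = ∑-threshold (suc n) s (λ i → U n i (f ∘ ℤ.suc)) (λ i → U n i f) (λ i → V n i (f ∘ ℤ.suc)) (s≤s s≤n)

-- Signed words

signed : List ℕ → List ℤ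
signed = concatMap (λ i → (+ i) ∷ (- (+ i)) ∷ [])

infixl 6 _∖_
_∖_ : List ℕ → ℕ → List ℕ
T ∖ x = filter (λ y → ¬? (x ℕ.≟ y)) T

∖-reject : ∀ x T → (x ∷ T) ∖ x ≡ T ∖ x
∖-reject x T = filter-reject (λ y → ¬? (x ℕ.≟ y)) (λ x≢x → x≢x refl)

∖-accept : ∀ {x y} T → x ≢ y → (y ∷ T) ∖ x ≡ y ∷ (T ∖ x)
∖-accept {x} T = filter-accept (λ y → ¬? (x ℕ.≟ y))

∑-signed : ∀ T f → ∑ (signed T) f ≡ ∑ T (λ τ → f (+ τ) + f (- (+ τ)))
∑-signed T f = trans (∑-concatMap _ T f)
  (∑-cong T λ τ → cong (_+_ (f (+ τ))) (ℤ.+-identityʳ (f (- (+ τ)))))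

filter-signed : ∀ x T → filter (λ b → ¬? (x ℕ.≟ ∣ b ∣)) (signed T) ≡ signed (T ∖ x)
filter-signed x []      = refl
filter-signed x (τ ∷ T) = go (x ℕ.≟ τ)
  where
  ∣-τ∣≡τ = ℤ.∣-i∣≡∣i∣ (+ τ)
  P? : Decidable (λ b → x ≢ ∣ b ∣)
  P? b = ¬? (x ℕ.≟ ∣ b ∣)
  go : Dec (x ≡ τ) → filter P? (signed (τ ∷ T)) ≡ signed ((τ ∷ T) ∖ x)
  go (yes x≡τ) = begin
    filter P? (signed (τ ∷ T))        ≡⟨ filter-reject P? (λ x≢τ → x≢τ x≡τ) ⟩
    filter P? (- (+ τ) ∷ signed T)    ≡⟨ filter-reject P? (λ x≢τ → x≢τ (trans x≡τ (sym ∣-τ∣≡τ))) ⟩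
    filter P? (signed T)              ≡⟨ filter-signed x T ⟩
    signed (T ∖ x)                    ≡⟨ cong signed (sym (subst (λ y → (y ∷ T) ∖ x ≡ T ∖ x) x≡τ (∖-reject x T))) ⟩
    signed ((τ ∷ T) ∖ x)              ∎
    where open ≡-Reasoning
  go (no x≢τ) = begin
    filter P? (signed (τ ∷ T))                  ≡⟨ filter-accept P? x≢τ ⟩
    + τ ∷ filter P? (- (+ τ) ∷ signed T)        ≡⟨ cong (+ τ ∷_) (filter-accept P? (λ x≡τ → x≢τ (trans x≡τ ∣-τ∣≡τ))) ⟩
    + τ ∷ - (+ τ) ∷ filter P? (signed T)        ≡⟨ cong (λ L → + τ ∷ - (+ τ) ∷ L) (filter-signed x T) ⟩
    signed (τ ∷ (T ∖ x))                        ≡⟨ cong signed (sym (∖-accept T x≢τ)) ⟩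
    signed ((τ ∷ T) ∖ x)                        ∎
    where open ≡-Reasoning

∑-words-suc : ∀ {A : Set} (L : List A) n f →
  ∑ (words L (suc n)) f ≡ ∑ L (λ a → ∑ (words L n) (λ w → f (a ∷ w)))
∑-words-suc L n f = trans
  (∑-concatMap (λ a → map (a ∷_) (words L n)) L f)
  (∑-cong L λ a → ∑-map (a ∷_) (words L n) f)

-- Avoiding an absolute value is a condition on each letter separately, so it amounts to shrinking
-- the alphabet. This turns the distinctness test into a recursion on the letters still available.
∑-words-avoid : ∀ x L n g →
  ∑ (words L n) (λ w → if not (memℕ x (map ∣_∣ w)) then g w else 0ℤ) ≡
  ∑ (words (filter (λ b → ¬? (x ℕ.≟ ∣ b ∣)) L) n) g
∑-words-avoid x L zero    g = refl
∑-words-avoid x L (suc n) g = begin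
  ∑ (words L (suc n)) (avoiding g)
    ≡⟨ ∑-words-suc L n (avoiding g) ⟩
  ∑ L (λ a → ∑ (words L n) (λ w → avoiding g (a ∷ w)))
    ≡⟨ ∑-cong L step ⟩
  ∑ L (λ a → if does (¬? (x ℕ.≟ ∣ a ∣)) then ∑ (words L′ n) (λ w → g (a ∷ w)) else 0ℤ)
    ≡⟨ sym (∑-filter (λ b → ¬? (x ℕ.≟ ∣ b ∣)) L (λ a → ∑ (words L′ n) (λ w → g (a ∷ w)))) ⟩
  ∑ L′ (λ a → ∑ (words L′ n) (λ w → g (a ∷ w)))
    ≡⟨ sym (∑-words-suc L′ n g) ⟩
  ∑ (words L′ (suc n)) g
    ∎
  where
  open ≡-Reasoning
  L′ = filter (λ b → ¬? (x ℕ.≟ ∣ b ∣)) L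
  avoiding : (List ℤ → ℤ) → List ℤ → ℤ
  avoiding g w = if not (memℕ x (map ∣_∣ w)) then g w else 0ℤ
  step : ∀ a → ∑ (words L n) (λ w → avoiding g (a ∷ w)) ≡
               (if does (¬? (x ℕ.≟ ∣ a ∣)) then ∑ (words L′ n) (λ w → g (a ∷ w)) else 0ℤ)
  step a = go (x ℕ.≟ ∣ a ∣)
    where
    go : (x? : Dec (x ≡ ∣ a ∣)) →
      ∑ (words L n) (λ w → if not (⌊ x? ⌋ ∨ memℕ x (map ∣_∣ w)) then g (a ∷ w) else 0ℤ) ≡
      (if does (¬? x?) then ∑ (words L′ n) (λ w → g (a ∷ w)) else 0ℤ)
    go (yes _) = ∑-zero (words L n)
    go (no _)  = ∑-words-avoid x L n (g ∘ (a ∷_))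

-- `T` lists the absolute values still available, `p` is the preceding letter, and `φ` evaluates the
-- descent number as in `U`. Keeping all of them variable allows the first letter to be split off.
W : List ℕ → ℕ → ℤ → (ℤ → ℤ) → ℤ
W T n p φ = ∑ (words (signed T) n) (λ w → if isSignedPerm w then φ (+ desFrom p w) else 0ℤ)

shiftIf : Bool → (ℤ → ℤ) → ℤ → ℤ
shiftIf b φ = if b then φ ∘ ℤ.suc else φ

-- The first letter is ±τ. Distinctness then removes τ from the available absolute values, and a
-- descent at the front shifts the evaluation.
W-suc : ∀ T n p φ → W T (suc n) p φ ≡
  ∑ T (λ τ → W (T ∖ τ) n (+ τ) (shiftIf ⌊ + τ ℤ.<? p ⌋ φ)
           + W (T ∖ τ) n (- (+ τ)) (shiftIf ⌊ - (+ τ) ℤ.<? p ⌋ φ))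
W-suc T n p φ = begin
  W T (suc n) p φ
    ≡⟨ ∑-words-suc (signed T) n _ ⟩
  ∑ (signed T) (λ a → ∑ (words (signed T) n) (λ w → if isSignedPerm (a ∷ w) then φ (+ desFrom p (a ∷ w)) else 0ℤ))
    ≡⟨ ∑-cong (signed T) (λ a → ∑-cong (words (signed T) n) (λ w → split a w)) ⟩
  ∑ (signed T) (λ a → ∑ (words (signed T) n) (λ w → if not (memℕ ∣ a ∣ (map ∣_∣ w)) then tail a w else 0ℤ))
    ≡⟨ ∑-cong (signed T) (λ a → trans (∑-words-avoid ∣ a ∣ (signed T) n (tail a))
         (cong (λ L → ∑ (words L n) (tail a)) (filter-signed ∣ a ∣ T))) ⟩
  ∑ (signed T) (λ a → W (T ∖ ∣ a ∣) n a (shiftIf ⌊ a ℤ.<? p ⌋ φ))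
    ≡⟨ ∑-signed T (λ a → W (T ∖ ∣ a ∣) n a (shiftIf ⌊ a ℤ.<? p ⌋ φ)) ⟩
  ∑ T (λ τ → W (T ∖ τ) n (+ τ) (shiftIf ⌊ + τ ℤ.<? p ⌋ φ)
           + W (T ∖ ∣ - (+ τ) ∣) n (- (+ τ)) (shiftIf ⌊ - (+ τ) ℤ.<? p ⌋ φ))
    ≡⟨ ∑-cong T (λ τ → cong (λ x → W (T ∖ τ) n (+ τ) (shiftIf ⌊ + τ ℤ.<? p ⌋ φ)
                                   + W (T ∖ x) n (- (+ τ)) (shiftIf ⌊ - (+ τ) ℤ.<? p ⌋ φ))
                            (ℤ.∣-i∣≡∣i∣ (+ τ))) ⟩
  _ ∎
  where
  open ≡-Reasoning
  tail : ℤ → List ℤ → ℤ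
  tail a w = if isSignedPerm w then shiftIf ⌊ a ℤ.<? p ⌋ φ (+ desFrom a w) else 0ℤ
  split : ∀ a w → (if isSignedPerm (a ∷ w) then φ (+ desFrom p (a ∷ w)) else 0ℤ) ≡
                  (if not (memℕ ∣ a ∣ (map ∣_∣ w)) then tail a w else 0ℤ)
  split a w with memℕ ∣ a ∣ (map ∣_∣ w) | isSignedPerm w | ⌊ a ℤ.<? p ⌋
  ... | true  | _     | _     = refl
  ... | false | false | _     = refl
  ... | false | true  | true  = refl
  ... | false | true  | false = refl

-- Ranks among the available absolute values

rank : ℕ → List ℕ → ℕ
rank q []      = 0
rank q (τ ∷ T) = (if τ <ᵇ q then 1 else 0) ℕ.+ rank q T

rank-≡0 : ∀ {q T} → All (q ℕ.<_) T → rank q T ≡ 0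
rank-≡0 []          = refl
rank-≡0 (q<τ ∷ q<T) rewrite <ᵇ-false (ℕ.<⇒≯ q<τ) = rank-≡0 q<T

rank-mono : ∀ {p q} T → p ℕ.≤ q → rank p T ℕ.≤ rank q T
rank-mono         []      p≤q = z≤n
rank-mono {p} {q} (τ ∷ T) p≤q = ℕ.+-mono-≤ head (rank-mono T p≤q)
  where
  head : (if τ <ᵇ p then 1 else 0) ℕ.≤ (if τ <ᵇ q then 1 else 0)
  head with τ ℕ.<? p
  ... | no τ≮p rewrite <ᵇ-false τ≮p = z≤n
  ... | yes τ<p rewrite <ᵇ-true τ<p | <ᵇ-true (ℕ.<-≤-trans τ<p p≤q) = ℕ.≤-refl

rank-< : ∀ {τ q T} → τ ∈ T → τ ℕ.< q → rank τ T ℕ.< rank q T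
rank-< {τ} {q} {τ ∷ T} (here refl) τ<q
  rewrite <ᵇ-false (ℕ.n≮n τ) | <ᵇ-true τ<q = s≤s (rank-mono T (ℕ.<⇒≤ τ<q))
rank-< {τ} {q} {σ ∷ T} (there τ∈T) τ<q with σ ℕ.<? τ
... | yes σ<τ rewrite <ᵇ-true σ<τ | <ᵇ-true (ℕ.<-trans σ<τ τ<q) = s≤s (rank-< τ∈T τ<q)
... | no σ≮τ rewrite <ᵇ-false σ≮τ = ℕ.<-≤-trans (rank-< τ∈T τ<q) (ℕ.m≤n+m (rank q T) _)

-- If τ < q, then τ itself is counted below `q` but not below τ, so the ranks differ strictly;
-- otherwise monotonicity of the rank suffices. Hence the tests on ranks in `U` and `V` can replace
-- comparisons of letters.
rank-<ᵇ : ∀ {τ T} q → τ ∈ T → (rank τ T <ᵇ rank q T) ≡ (τ <ᵇ q)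
rank-<ᵇ {τ} {T} q τ∈T with τ ℕ.<? q
... | yes τ<q = trans (<ᵇ-true (rank-< τ∈T τ<q)) (sym (<ᵇ-true τ<q))
... | no τ≮q  = trans (<ᵇ-false (ℕ.≤⇒≯ (rank-mono T (ℕ.≮⇒≥ τ≮q)))) (sym (<ᵇ-false τ≮q))

rank-∖ : ∀ τ T → rank τ (T ∖ τ) ≡ rank τ T
rank-∖ τ []      = refl
rank-∖ τ (σ ∷ T) = go (τ ℕ.≟ σ)
  where
  go : Dec (τ ≡ σ) → rank τ ((σ ∷ T) ∖ τ) ≡ rank τ (σ ∷ T)
  go (yes refl) rewrite <ᵇ-false (ℕ.n≮n τ) = trans (cong (rank τ) (∖-reject τ T)) (rank-∖ τ T)
  go (no τ≢σ)   = trans (cong (rank τ) (∖-accept T τ≢σ))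
                        (cong ((if σ <ᵇ τ then 1 else 0) ℕ.+_) (rank-∖ τ T))

Sorted : List ℕ → Set
Sorted = AllPairs ℕ._<_

length-∖ : ∀ {τ T} → Sorted T → τ ∈ T → suc (length (T ∖ τ)) ≡ length T
length-∖ {τ} {.τ ∷ T} (σ<T ∷ sT) (here refl) = cong (suc ∘ length)
  (trans (∖-reject τ T) (filter-all (λ y → ¬? (τ ℕ.≟ y)) (All.map ℕ.<⇒≢ σ<T)))
length-∖ {τ} {σ ∷ T} (σ<T ∷ sT) (there τ∈T) =
  trans (cong (suc ∘ length) (∖-accept T (ℕ.>⇒≢ (All.lookup σ<T τ∈T)))) (cong suc (length-∖ sT τ∈T))

-- Along a sorted list the ranks are 0, 1, 2, ..., so a sum over letters becomes the index sum of
-- `U` and `V`.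
∑-rank : ∀ {T} → Sorted T → ∀ F → ∑ T (λ τ → F (rank τ T)) ≡ ∑ (upTo (length T)) F
∑-rank []              F = refl
∑-rank {σ ∷ T} (σ<T ∷ sT) F = begin
  F (rank σ (σ ∷ T)) + ∑ T (λ τ → F (rank τ (σ ∷ T)))
    ≡⟨ cong₂ _+_ (cong F head) (∑-cong-∈ T (cong F ∘ tail)) ⟩
  F 0 + ∑ T (λ τ → F (suc (rank τ T)))
    ≡⟨ cong (_+_ (F 0)) (∑-rank sT (F ∘ suc)) ⟩
  F 0 + ∑ (upTo (length T)) (F ∘ suc)
    ≡⟨ sym (∑-upTo-suc (length T) F) ⟩
  ∑ (upTo (suc (length T))) F
    ∎
  where
  open ≡-Reasoning
  head : rank σ (σ ∷ T) ≡ 0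
  head rewrite <ᵇ-false (ℕ.n≮n σ) = rank-≡0 σ<T
  tail : ∀ {τ} → τ ∈ T → rank τ (σ ∷ T) ≡ suc (rank τ T)
  tail τ∈T rewrite <ᵇ-true (All.lookup σ<T τ∈T) = refl

if-float : ∀ b (F : (ℤ → ℤ) → ℤ) φ → F (shiftIf b φ) ≡ (if b then F (φ ∘ ℤ.suc) else F φ)
if-float true  F φ = refl
if-float false F φ = refl

<?-pos-pos : ∀ τ q → ⌊ + τ ℤ.<? + q ⌋ ≡ (τ <ᵇ q)
<?-pos-pos τ q = isYes≗does (+ τ ℤ.<? + q)

<?-neg-pos : ∀ {τ} q → 0 ℕ.< τ → ⌊ - (+ τ) ℤ.<? + q ⌋ ≡ true
<?-neg-pos {suc τ} q _ = refl

<?-pos-neg : ∀ τ q → ⌊ + τ ℤ.<? - (+ q) ⌋ ≡ false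
<?-pos-neg τ zero    = refl
<?-pos-neg τ (suc q) = refl

-- Negation reverses the order; `q ≢ τ` rules out the tie, where both strict comparisons fail.
<?-neg-neg : ∀ {τ q} → q ≢ τ → ⌊ - (+ τ) ℤ.<? - (+ q) ⌋ ≡ not (τ <ᵇ q)
<?-neg-neg {zero}  {zero}  q≢τ = ⊥-elim (q≢τ refl)
<?-neg-neg {zero}  {suc q} q≢τ = refl
<?-neg-neg {suc τ} {zero}  q≢τ = refl
<?-neg-neg {suc τ} {suc q} q≢τ rewrite isYes≗does (-[1+ τ ] ℤ.<? -[1+ q ]) with τ ℕ.<? q
... | yes τ<q = trans (<ᵇ-false (ℕ.<⇒≯ τ<q)) (cong not (sym (<ᵇ-true τ<q)))
... | no τ≮q  = trans (<ᵇ-true (ℕ.≤∧≢⇒< (ℕ.≮⇒≥ τ≮q) (q≢τ ∘ cong suc))) (cong not (sym (<ᵇ-false τ≮q)))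

if-not : ∀ b {x y : A} → (if not b then x else y) ≡ (if b then y else x)
if-not true  = refl
if-not false = refl

-- Only the position of the preceding letter among the available absolute values matters. The proof
-- is a mutual induction on the number of letters: after ±τ is chosen, the rank of τ among the
-- remaining letters equals its rank in `T`, which is the summation index of `U` and `V`.
W≡U : ∀ n {T} q → length T ≡ n → Sorted T → All (0 ℕ.<_) T → All (q ≢_) T →
      ∀ φ → W T n (+ q) φ ≡ U n (rank q T) φ
W≡V : ∀ n {T} q → length T ≡ n → Sorted T → All (0 ℕ.<_) T → All (q ≢_) T →
      ∀ φ → W T n (- (+ q)) φ ≡ V n (rank q T) φ

module _ n {T} (len : length T ≡ suc n) (sT : Sorted T) (0<T : All (0 ℕ.<_) T) {τ} (τ∈T : τ ∈ T) where

  private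
    len∖ : length (T ∖ τ) ≡ n
    len∖ = ℕ.suc-injective (trans (length-∖ sT τ∈T) len)

    τ∉ : All (τ ≢_) (T ∖ τ)
    τ∉ = All.all-filter (λ y → ¬? (τ ℕ.≟ y)) T

    dec : Decidable (τ ≢_)
    dec y = ¬? (τ ℕ.≟ y)

  W∖≡U : ∀ φ → W (T ∖ τ) n (+ τ) φ ≡ U n (rank τ T) φ
  W∖≡U φ = trans
    (W≡U n τ len∖ (AllPairs.filter⁺ dec sT) (All.filter⁺ dec 0<T) τ∉ φ)
    (cong (λ r → U n r φ) (rank-∖ τ T))

  W∖≡V : ∀ φ → W (T ∖ τ) n (- (+ τ)) φ ≡ V n (rank τ T) φ
  W∖≡V φ = trans
    (W≡V n τ len∖ (AllPairs.filter⁺ dec sT) (All.filter⁺ dec 0<T) τ∉ φ)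
    (cong (λ r → V n r φ) (rank-∖ τ T))

W≡U zero    {[]} q refl _ _ _ φ = ℤ.+-identityʳ _
W≡U (suc n) {T} q len sT 0<T q∉T φ = begin
  W T (suc n) (+ q) φ                            ≡⟨ W-suc T n (+ q) φ ⟩
  _                                              ≡⟨ ∑-cong-∈ T step ⟩
  ∑ T (λ τ → U-step n (rank q T) φ (rank τ T))   ≡⟨ ∑-rank sT (U-step n (rank q T) φ) ⟩
  ∑ (upTo (length T)) (U-step n (rank q T) φ)    ≡⟨ cong (λ m → ∑ (upTo m) (U-step n (rank q T) φ)) len ⟩
  U (suc n) (rank q T) φ                         ∎
  where
  open ≡-Reasoning
  step : ∀ {τ} → τ ∈ T →
    W (T ∖ τ) n (+ τ) (shiftIf ⌊ + τ ℤ.<? + q ⌋ φ) + W (T ∖ τ) n (- (+ τ)) (shiftIf ⌊ - (+ τ) ℤ.<? + q ⌋ φ)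
      ≡ U-step n (rank q T) φ (rank τ T)
  step {τ} τ∈T
    rewrite <?-pos-pos τ q | <?-neg-pos q (All.lookup 0<T τ∈T) | rank-<ᵇ q τ∈T = cong₂ _+_
      (trans (W∖≡U n len sT 0<T τ∈T _) (if-float (τ <ᵇ q) (U n (rank τ T)) φ))
      (W∖≡V n len sT 0<T τ∈T _)

W≡V zero    {[]} q refl _ _ _ φ = ℤ.+-identityʳ _
W≡V (suc n) {T} q len sT 0<T q∉T φ = begin
  W T (suc n) (- (+ q)) φ                        ≡⟨ W-suc T n (- (+ q)) φ ⟩
  _                                              ≡⟨ ∑-cong-∈ T step ⟩
  ∑ T (λ τ → V-step n (rank q T) φ (rank τ T))   ≡⟨ ∑-rank sT (V-step n (rank q T) φ) ⟩
  ∑ (upTo (length T)) (V-step n (rank q T) φ)    ≡⟨ cong (λ m → ∑ (upTo m) (V-step n (rank q T) φ)) len ⟩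
  V (suc n) (rank q T) φ                         ∎
  where
  open ≡-Reasoning
  step : ∀ {τ} → τ ∈ T →
    W (T ∖ τ) n (+ τ) (shiftIf ⌊ + τ ℤ.<? - (+ q) ⌋ φ) + W (T ∖ τ) n (- (+ τ)) (shiftIf ⌊ - (+ τ) ℤ.<? - (+ q) ⌋ φ)
      ≡ V-step n (rank q T) φ (rank τ T)
  step {τ} τ∈T
    rewrite <?-pos-neg τ q | <?-neg-neg (All.lookup q∉T τ∈T) | rank-<ᵇ q τ∈T = cong₂ _+_
      (W∖≡U n len sT 0<T τ∈T _)
      (trans (W∖≡V n len sT 0<T τ∈T _)
        (trans (if-float (not (τ <ᵇ q)) (V n (rank τ T)) φ) (if-not (τ <ᵇ q))))

-- The convention π₀ = 0 starts the word at rank 0 among 1, ..., n, so `U n 0` is the type B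
-- Eulerian polynomial.
∑-signedPerms : ∀ n φ → ∑ (signedPerms n) (λ π → φ (+ desB π)) ≡ U n 0 φ
∑-signedPerms n φ = begin
  ∑ (signedPerms n) (λ π → φ (+ desB π))
    ≡⟨ ∑-filter (λ w → isSignedPerm w Bool.≟ true) (words (signedLetters n) n) (λ π → φ (+ desB π)) ⟩
  ∑ (words (signedLetters n) n) (λ w → if does (isSignedPerm w Bool.≟ true) then φ (+ desB w) else 0ℤ)
    ≡⟨ ∑-cong (words (signedLetters n) n) (λ w → cong (λ b → if b then φ (+ desB w) else 0ℤ) (≟true (isSignedPerm w))) ⟩
  W (range 1 n) n 0ℤ φ
    ≡⟨ W≡U n 0 (trans (length-map suc (upTo n)) (length-upTo n)) sorted 0<range (All.map ℕ.<⇒≢ 0<range) φ ⟩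
  U n (rank 0 (range 1 n)) φ
    ≡⟨ cong (λ r → U n r φ) (rank-≡0 0<range) ⟩
  U n 0 φ
    ∎
  where
  open ≡-Reasoning
  ≟true : ∀ b → does (b Bool.≟ true) ≡ b
  ≟true true  = refl
  ≟true false = refl
  range≡ : range 1 n ≡ applyUpTo suc n
  range≡ = map-upTo suc n
  sorted : Sorted (range 1 n)
  sorted = subst Sorted (sym range≡) (AllPairs.applyUpTo⁺₁ suc n (λ i<j _ → s≤s i<j))
  0<range : All (0 ℕ.<_) (range 1 n)
  0<range = subst (All (0 ℕ.<_)) (sym range≡) (All.applyUpTo⁺₂ suc n (λ _ → s≤s z≤n))

-- Coefficients of Hₖ

δ : ℤ → ℤ → ℤ
δ e f = if ⌊ f ℤ.≟ e ⌋ then 1ℤ else 0ℤ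

δ-≢ : ∀ {e f} → f ≢ e → δ e f ≡ 0ℤ
δ-≢ {e} {f} f≢e with f ℤ.≟ e
... | yes f≡e = ⊥-elim (f≢e f≡e)
... | no _    = refl

δ-≡ : ∀ {e f} → f ≡ e → δ e f ≡ 1ℤ
δ-≡ {e} {f} f≡e with f ℤ.≟ e
... | yes _  = refl
... | no f≢e = ⊥-elim (f≢e f≡e)

δ-⇔ : ∀ {e f e′ f′} → (f ≡ e → f′ ≡ e′) → (f′ ≡ e′ → f ≡ e) → δ e f ≡ δ e′ f′
δ-⇔ {e} {f} to from with f ℤ.≟ e
... | yes f≡e = sym (δ-≡ (to f≡e))
... | no f≢e  = sym (δ-≢ (f≢e ∘ from))

δ-nonNeg : ∀ e f → 0ℤ ≤ δ e f
δ-nonNeg e f with ⌊ f ℤ.≟ e ⌋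
... | true  = ℤ.+≤+ z≤n
... | false = ℤ.≤-refl

-- The linear functional sending xᵉ to `φ e`. Products become nested evaluations, and the choice
-- `δ e` recovers coefficients, so Laurent polynomials never have to be brought to a normal form.
ev : Laurent → (ℤ → ℤ) → ℤ
ev p φ = ∑ p (λ { (c , e) → c * φ e })

ev-cong : ∀ p {φ χ} → (∀ e → φ e ≡ χ e) → ev p φ ≡ ev p χ
ev-cong p eq = ∑-cong p (λ { (c , e) → cong (c *_) (eq e) })

coeff≡ev : ∀ p e → coeff p e ≡ ev p (δ e)
coeff≡ev []            e = refl
coeff≡ev ((c , f) ∷ p) e = cong₂ _+_ head (coeff≡ev p e)
  where
  head : (if ⌊ f ℤ.≟ e ⌋ then c else 0ℤ) ≡ c * δ e f
  head with ⌊ f ℤ.≟ e ⌋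
  ... | true  = sym (ℤ.*-identityʳ c)
  ... | false = sym (ℤ.*-zeroʳ c)

ev-⊗ : ∀ p q φ → ev (p ⊗ q) φ ≡ ev p (λ e → ev q (λ f → φ (e + f)))
ev-⊗ []            q φ = refl
ev-⊗ ((c , e) ∷ p) q φ = begin
  ev (map _ q ++ p ⊗ q) φ                                       ≡⟨ ∑-++ (map _ q) (p ⊗ q) _ ⟩
  ∑ (map _ q) _ + ev (p ⊗ q) φ                                  ≡⟨ cong₂ _+_ head (ev-⊗ p q φ) ⟩
  c * ev q (λ f → φ (e + f)) + ev p (λ e → ev q (λ f → φ (e + f)))  ∎
  where
  open ≡-Reasoning
  head : ∑ (map (λ { (d , f) → (c * d , e + f) }) q) (λ { (c , e) → c * φ e }) ≡ c * ev q (λ f → φ (e + f))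
  head = trans (∑-map _ q _)
    (trans (∑-cong q (λ { (d , f) → ℤ.*-assoc c d (φ (e + f)) })) (∑-*ˡ c q _))

ev-ΣL : ∀ is p φ → ev (ΣL is p) φ ≡ ∑ is (λ i → ev (p i) φ)
ev-ΣL []       p φ = refl
ev-ΣL (i ∷ is) p φ = trans (∑-++ (p i) (ΣL is p) _) (cong (_+_ (ev (p i) φ)) (ev-ΣL is p φ))

ev-mono : ∀ c e φ → ev (mono c e) φ ≡ c * φ e
ev-mono c e φ = ℤ.+-identityʳ (c * φ e)

ev-∑ : ∀ p (xs : List A) (k : A → ℤ) (φ : A → ℤ → ℤ) →
       ev p (λ e → ∑ xs (λ x → k x * φ x e)) ≡ ∑ xs (λ x → k x * ev p (φ x))
ev-∑ p xs k φ = begin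
  ∑ p (λ t → proj₁ t * ∑ xs (λ x → k x * φ x (proj₂ t)))
    ≡⟨ ∑-cong p (λ t → sym (∑-*ˡ (proj₁ t) xs (λ x → k x * φ x (proj₂ t)))) ⟩
  ∑ p (λ t → ∑ xs (λ x → proj₁ t * (k x * φ x (proj₂ t))))
    ≡⟨ ∑-swap p xs (λ t x → proj₁ t * (k x * φ x (proj₂ t))) ⟩
  ∑ xs (λ x → ∑ p (λ t → proj₁ t * (k x * φ x (proj₂ t))))
    ≡⟨ ∑-cong xs (λ x → trans (∑-cong p (λ t → lemma (proj₁ t) (k x) (φ x (proj₂ t))))
                              (∑-*ˡ (k x) p (λ t → proj₁ t * φ x (proj₂ t)))) ⟩
  ∑ xs (λ x → k x * ev p (φ x))
    ∎
  where
  open ≡-Reasoning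
  lemma : ∀ a b c → a * (b * c) ≡ b * (a * c)
  lemma = solve-∀

ev-eulerianB : ∀ m n χ → ev (substPow m (eulerianB n)) χ ≡ U n 0 (λ d → χ (d * m))
ev-eulerianB m n χ = begin
  ev (substPow m (eulerianB n)) χ
    ≡⟨ ∑-map _ (eulerianB n) _ ⟩
  ∑ (eulerianB n) (λ t → proj₁ t * χ (proj₂ t * m))
    ≡⟨ ∑-map _ (signedPerms n) _ ⟩
  ∑ (signedPerms n) (λ π → 1ℤ * χ (+ desB π * m))
    ≡⟨ ∑-cong (signedPerms n) (λ π → ℤ.*-identityˡ (χ (+ desB π * m))) ⟩
  ∑ (signedPerms n) (λ π → χ (+ desB π * m))
    ≡⟨ ∑-signedPerms n (λ d → χ (d * m)) ⟩
  U n 0 (λ d → χ (d * m))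
    ∎
  where open ≡-Reasoning

-- Finite differences and the binomial expansion of `U`

Δ : (ℤ → ℤ) → ℤ → ℤ
Δ ψ d = ψ (ℤ.suc d) - ψ d

Δ^ : ℕ → (ℤ → ℤ) → ℤ → ℤ
Δ^ zero    ψ = ψ
Δ^ (suc l) ψ = Δ (Δ^ l ψ)

-- Moves one difference from the outside into the evaluation, as the induction for `U-binomial`
-- requires.
Δ^-Δ : ∀ l ψ d → Δ (Δ^ l ψ) d ≡ Δ^ l (Δ ψ) d
Δ^-Δ zero    ψ d = refl
Δ^-Δ (suc l) ψ d = cong₂ _-_ (Δ^-Δ l ψ (ℤ.suc d)) (Δ^-Δ l ψ d)

-- With t = xᵐ, multiplication by t - 1 acts on evaluations as the forward difference in the
-- exponent `d` of t; each further factor is one more difference.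
ev-powL : ∀ m l (Φ : ℤ → ℤ) d → ev (powL (mono 1ℤ m ⊖ constL 1ℤ) l) (λ b → Φ (d * m + b)) ≡ Δ^ l (λ d → Φ (d * m)) d
ev-powL m zero Φ d = begin
  1ℤ * Φ (d * m + 0ℤ) + 0ℤ  ≡⟨ ℤ.+-identityʳ _ ⟩
  1ℤ * Φ (d * m + 0ℤ)       ≡⟨ ℤ.*-identityˡ _ ⟩
  Φ (d * m + 0ℤ)            ≡⟨ cong Φ (ℤ.+-identityʳ (d * m)) ⟩
  Φ (d * m)                 ∎
  where open ≡-Reasoning
ev-powL m (suc l) Φ d = begin
  ev (x-1 ⊗ q) (λ b → Φ (d * m + b))
    ≡⟨ ev-⊗ x-1 q (λ b → Φ (d * m + b)) ⟩
  1ℤ * ev q (λ b → Φ (d * m + (m + b))) + (ℤ.- 1ℤ * ev q (λ b → Φ (d * m + (0ℤ + b))) + 0ℤ)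
    ≡⟨ lemma (ev q (λ b → Φ (d * m + (m + b)))) (ev q (λ b → Φ (d * m + (0ℤ + b)))) ⟩
  ev q (λ b → Φ (d * m + (m + b))) - ev q (λ b → Φ (d * m + (0ℤ + b)))
    ≡⟨ cong₂ _-_ (ev-cong q (λ b → cong Φ (shift d m b))) (ev-cong q (λ b → cong (Φ ∘ (_+_ (d * m))) (ℤ.+-identityˡ b))) ⟩
  ev q (λ b → Φ (ℤ.suc d * m + b)) - ev q (λ b → Φ (d * m + b))
    ≡⟨ cong₂ _-_ (ev-powL m l Φ (ℤ.suc d)) (ev-powL m l Φ d) ⟩
  Δ^ (suc l) (λ d → Φ (d * m)) d
    ∎
  where
  open ≡-Reasoning
  x-1 = mono 1ℤ m ⊖ constL 1ℤ
  q = powL x-1 l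
  lemma : ∀ a b → 1ℤ * a + (ℤ.- 1ℤ * b + 0ℤ) ≡ a - b
  lemma = solve-∀
  shift : ∀ d m b → d * m + (m + b) ≡ (1ℤ + d) * m + b
  shift = solve-∀

nC0≡1 : ∀ n → n C 0 ≡ 1
nC0≡1 n = trans (nCk≡nC[n∸k] {k = 0} {n = n} z≤n) (nCn≡1 n)

-- This is `U-suc` iterated from `U k 0`. In the inductive step Pascal's rule splits the sum into
-- the one for `s` and `suc k` with the same evaluation, and a shifted one, which is the sum for `s`
-- and `k` with evaluation `Δ ψ`.
U-binomial : ∀ s k ψ → s ℕ.≤ k →
  ∑ (upTo (suc k)) (λ l → + (s C l) * U (k ℕ.∸ l) 0 (Δ^ l ψ)) ≡ U k s ψ
U-binomial zero k ψ s≤k = begin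
  ∑ (upTo (suc k)) f   ≡⟨ ∑-upTo-single (suc k) f 0 (s≤s z≤n) vanish ⟩
  + (0 C 0) * U k 0 ψ  ≡⟨ ℤ.*-identityˡ (U k 0 ψ) ⟩
  U k 0 ψ              ∎
  where
  open ≡-Reasoning
  f : ℕ → ℤ
  f l = + (0 C l) * U (k ℕ.∸ l) 0 (Δ^ l ψ)
  vanish : ∀ l → l ℕ.< suc k → l ≢ 0 → f l ≡ 0ℤ
  vanish l _ l≢0 = cong (λ c → + c * U (k ℕ.∸ l) 0 (Δ^ l ψ)) (k>n⇒nCk≡0 (ℕ.n≢0⇒n>0 l≢0))
U-binomial (suc s) (suc k) ψ (s≤s s≤k) = begin
  ∑ (upTo (suc (suc k))) (λ l → + (suc s C l) * X l)
    ≡⟨ ∑-upTo-suc (suc k) (λ l → + (suc s C l) * X l) ⟩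
  + (suc s C 0) * X 0 + ∑ (upTo (suc k)) (λ l → + (suc s C suc l) * X (suc l))
    ≡⟨ cong₂ _+_ (cong (λ c → + c * X 0) (trans (nC0≡1 (suc s)) (sym (nC0≡1 s))))
         (trans (∑-cong (upTo (suc k)) pascal)
                (∑-+ (upTo (suc k)) (λ l → + (s C suc l) * X (suc l)) (λ l → + (s C l) * X (suc l)))) ⟩
  + (s C 0) * X 0 + (∑ (upTo (suc k)) (λ l → + (s C suc l) * X (suc l)) + Y)
    ≡⟨ sym (ℤ.+-assoc (+ (s C 0) * X 0) _ Y) ⟩
  + (s C 0) * X 0 + ∑ (upTo (suc k)) (λ l → + (s C suc l) * X (suc l)) + Y
    ≡⟨ cong (_+ Y) (sym (∑-upTo-suc (suc k) (λ l → + (s C l) * X l))) ⟩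
  ∑ (upTo (suc (suc k))) (λ l → + (s C l) * X l) + Y
    ≡⟨ cong₂ _+_ (U-binomial s (suc k) ψ (ℕ.m≤n⇒m≤1+n s≤k)) Y≡ ⟩
  U (suc k) s ψ + (U k s (ψ ∘ ℤ.suc) - U k s ψ)
    ≡⟨ sym (U-suc k s ψ s≤k) ⟩
  U (suc k) (suc s) ψ
    ∎
  where
  open ≡-Reasoning
  X : ℕ → ℤ
  X l = U (suc k ℕ.∸ l) 0 (Δ^ l ψ)
  Y = ∑ (upTo (suc k)) (λ l → + (s C l) * X (suc l))
  pascal : ∀ l → + (suc s C suc l) * X (suc l) ≡ + (s C suc l) * X (suc l) + + (s C l) * X (suc l)
  pascal l = begin
    + (suc s C suc l) * X (suc l)                           ≡⟨ cong (λ c → + c * X (suc l)) (sym (nCk+nC[k+1]≡[n+1]C[k+1] s l)) ⟩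
    + (s C l ℕ.+ s C suc l) * X (suc l)                     ≡⟨ cong (λ c → + c * X (suc l)) (ℕ.+-comm (s C l) (s C suc l)) ⟩
    (+ (s C suc l) + + (s C l)) * X (suc l)                 ≡⟨ ℤ.*-distribʳ-+ (X (suc l)) (+ (s C suc l)) (+ (s C l)) ⟩
    + (s C suc l) * X (suc l) + + (s C l) * X (suc l)       ∎
  Y≡ : Y ≡ U k s (ψ ∘ ℤ.suc) - U k s ψ
  Y≡ = begin
    Y
      ≡⟨ ∑-cong (upTo (suc k)) (λ l → cong (+ (s C l) *_) (U-cong (k ℕ.∸ l) 0 (Δ^-Δ l ψ))) ⟩
    ∑ (upTo (suc k)) (λ l → + (s C l) * U (k ℕ.∸ l) 0 (Δ^ l (Δ ψ)))
      ≡⟨ U-binomial s k (Δ ψ) s≤k ⟩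
    U k s (Δ ψ)
      ≡⟨ U-sub k s (ψ ∘ ℤ.suc) ψ ⟩
    U k s (ψ ∘ ℤ.suc) - U k s ψ
      ∎

-- Evaluating the two sums of Hₖ

half : ℕ → ℤ → (ℕ → ℤ) → Laurent
half k m c = ΣL (range 0 k) (λ l →
    substPow m (eulerianB (k ℕ.∸ l))
  ⊗ powL (mono 1ℤ m ⊖ constL 1ℤ) l
  ⊗ ΣL (range l k) (λ s → mono (+ (s C l)) (c s)))

-- After the sums over `l` and `s` are exchanged, the inner sum over `l` is the binomial expansion
-- of `U k s`. Both sums of Hₖ are instances, with opposite signs of `m`.
ev-half : ∀ k m c φ → ev (half k m c) φ ≡ ∑ (upTo (suc k)) (λ s → U k s (λ d → φ (d * m + c s)))
ev-half k m c φ = begin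
  ev (half k m c) φ
    ≡⟨ ev-ΣL (range 0 k) (λ l → p l ⊗ q l ⊗ r l) φ ⟩
  ∑ (range 0 k) (λ l → ev (p l ⊗ q l ⊗ r l) φ)
    ≡⟨ ∑-range 0 k (λ l → ev (p l ⊗ q l ⊗ r l) φ) ⟩
  ∑ (upTo (suc k)) (λ l → ev (p l ⊗ q l ⊗ r l) φ)
    ≡⟨ ∑-cong-∈ (upTo (suc k)) (λ l∈ → summand _ (ℕ.≤-pred (∈-upTo⁻ l∈))) ⟩
  ∑ (upTo (suc k)) (λ l → ∑ (upTo (suc k)) (λ s → + (s C l) * X s l))
    ≡⟨ ∑-swap (upTo (suc k)) (upTo (suc k)) (λ l s → + (s C l) * X s l) ⟩
  ∑ (upTo (suc k)) (λ s → ∑ (upTo (suc k)) (λ l → + (s C l) * X s l))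
    ≡⟨ ∑-cong-∈ (upTo (suc k)) (λ {s} s∈ → U-binomial s k (ψ s) (ℕ.≤-pred (∈-upTo⁻ s∈))) ⟩
  ∑ (upTo (suc k)) (λ s → U k s (ψ s))
    ∎
  where
  open ≡-Reasoning
  p q r : ℕ → Laurent
  p l = substPow m (eulerianB (k ℕ.∸ l))
  q l = powL (mono 1ℤ m ⊖ constL 1ℤ) l
  r l = ΣL (range l k) (λ s → mono (+ (s C l)) (c s))
  ψ : ℕ → ℤ → ℤ
  ψ s d = φ (d * m + c s)
  X : ℕ → ℕ → ℤ
  X s l = U (k ℕ.∸ l) 0 (Δ^ l (ψ s))
  ev-r : ∀ l χ → ev (r l) χ ≡ ∑ (range l k) (λ s → + (s C l) * χ (c s))
  ev-r l χ = trans (ev-ΣL (range l k) _ χ) (∑-cong (range l k) (λ s → ev-mono (+ (s C l)) (c s) χ))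
  summand : ∀ l → l ℕ.≤ k → ev (p l ⊗ q l ⊗ r l) φ ≡ ∑ (upTo (suc k)) (λ s → + (s C l) * X s l)
  summand l l≤k = begin
    ev (p l ⊗ q l ⊗ r l) φ
      ≡⟨ ev-⊗ (p l ⊗ q l) (r l) φ ⟩
    ev (p l ⊗ q l) (λ e → ev (r l) (λ f → φ (e + f)))
      ≡⟨ ev-⊗ (p l) (q l) _ ⟩
    ev (p l) (λ a → ev (q l) (λ b → ev (r l) (λ f → φ ((a + b) + f))))
      ≡⟨ ev-cong (p l) (λ a → trans
           (ev-cong (q l) (λ b → ev-r l (λ f → φ ((a + b) + f))))
           (ev-∑ (q l) (range l k) (λ s → + (s C l)) (λ s b → φ ((a + b) + c s)))) ⟩
    ev (p l) (λ a → ∑ (range l k) (λ s → + (s C l) * ev (q l) (λ b → φ ((a + b) + c s))))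
      ≡⟨ ev-∑ (p l) (range l k) (λ s → + (s C l)) (λ s a → ev (q l) (λ b → φ ((a + b) + c s))) ⟩
    ∑ (range l k) (λ s → + (s C l) * ev (p l) (λ a → ev (q l) (λ b → φ ((a + b) + c s))))
      ≡⟨ ∑-cong (range l k) (λ s → cong (+ (s C l) *_) (trans
           (ev-eulerianB m (k ℕ.∸ l) _)
           (U-cong (k ℕ.∸ l) 0 (ev-powL m l (λ e → φ (e + c s)))))) ⟩
    ∑ (range l k) (λ s → + (s C l) * X s l)
      ≡⟨ ∑-range l k (λ s → + (s C l) * X s l) ⟩
    ∑ (upTo (suc k ℕ.∸ l)) (λ i → + ((l ℕ.+ i) C l) * X (l ℕ.+ i) l)
      -- Binomials with s < l vanish, so the sum may start at 0. Its range is then independent of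
      -- `l`, which permits the exchange of sums.
      ≡⟨ sym (∑-upTo-drop l (suc k) (λ s → + (s C l) * X s l)
           (λ s s<l → cong (λ c → + c * X s l) (k>n⇒nCk≡0 s<l)) (ℕ.m≤n⇒m≤1+n l≤k)) ⟩
    ∑ (upTo (suc k)) (λ s → + (s C l) * X s l)
      ∎

coeff-Hk : ∀ k e → coeff (Hk k) e ≡
    ∑ (upTo (suc k)) (λ s → U k s (λ d → δ e (d * + (2 ℕ.* k ℕ.+ 2) + (+ (2 ℕ.* k ℕ.+ 1) - + s))))
  + ∑ (upTo (suc k)) (λ s → U k s (λ d → δ e (d * - (+ (2 ℕ.* k ℕ.+ 2)) + + (2 ℕ.* ((k ℕ.+ 1) ℕ.* (k ℕ.+ 1)) ℕ.+ s))))
coeff-Hk k e = begin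
  coeff (Hk k) e
    ≡⟨ coeff≡ev (Hk k) e ⟩
  ev (half k (+ m) c₁ ⊕ half k (- (+ m)) c₂) (δ e)
    ≡⟨ ∑-++ (half k (+ m) c₁) (half k (- (+ m)) c₂) _ ⟩
  ev (half k (+ m) c₁) (δ e) + ev (half k (- (+ m)) c₂) (δ e)
    ≡⟨ cong₂ _+_ (ev-half k (+ m) c₁ (δ e)) (ev-half k (- (+ m)) c₂ (δ e)) ⟩
  _ ∎
  where
  open ≡-Reasoning
  m = 2 ℕ.* k ℕ.+ 2
  c₁ c₂ : ℕ → ℤ
  c₁ s = + (2 ℕ.* k ℕ.+ 1) - + s
  c₂ s = + (2 ℕ.* ((k ℕ.+ 1) ℕ.* (k ℕ.+ 1)) ℕ.+ s)

-- Reading off coefficients by quotient and remainder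

quotient-≮ : ∀ M x y a b → a ℕ.< M → x * + M + + a ≡ y * + M + + b → ¬ x ℤ.< y
-- If x < y, then y M + b is at least x M + M, which exceeds x M + a.
quotient-≮ M x y a b a<M eq x<y = ℕ.<⇒≱ a<M (ℤ.drop‿+≤+ (ℤ.0≤i-j⇒j≤i (subst (0ℤ ≤_) rearrange
  (ℤ.+-mono-≤ (ℤ.i≤j⇒0≤j-i (ℤ.*-monoʳ-≤-nonNeg (+ M) (ℤ.i<j⇒suc[i]≤j x<y))) (ℤ.+≤+ (z≤n {b}))))))
  where
  open ≡-Reasoning
  lemma₁ : ∀ x y M b → (y * M - (1ℤ + x) * M) + b ≡ (y * M + b) - (x * M + M)
  lemma₁ = solve-∀
  lemma₂ : ∀ x M a → (x * M + a) - (x * M + M) ≡ a - M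
  lemma₂ = solve-∀
  rearrange : (y * + M - ℤ.suc x * + M) + + b ≡ + a - + M
  rearrange = begin
    (y * + M - ℤ.suc x * + M) + + b       ≡⟨ lemma₁ x y (+ M) (+ b) ⟩
    (y * + M + + b) - (x * + M + + M)     ≡⟨ cong (_- (x * + M + + M)) (sym eq) ⟩
    (x * + M + + a) - (x * + M + + M)     ≡⟨ lemma₂ x (+ M) (+ a) ⟩
    + a - + M                             ∎

quotient-unique : ∀ M x y a b → a ℕ.< M → b ℕ.< M → x * + M + + a ≡ y * + M + + b → x ≡ y
quotient-unique M x y a b a<M b<M eq = ℤ.≤-antisym
  (ℤ.≮⇒≥ (quotient-≮ M y x b a b<M (sym eq))) (ℤ.≮⇒≥ (quotient-≮ M x y a b a<M eq))

remainder-unique : ∀ M x y a b → a ℕ.< M → b ℕ.< M → x * + M + + a ≡ y * + M + + b → a ≡ b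
remainder-unique M x y a b a<M b<M eq = ℤ.+-injective (∙-cancelˡ (x * + M) (+ a) (+ b)
  (trans eq (cong (λ z → z * + M + + b) (sym (quotient-unique M x y a b a<M b<M eq)))))

u : ℕ → ℕ → ℤ → ℤ
u k s j = U k s (δ j)

module Position (k : ℕ) where

  m : ℕ
  m = 2 ℕ.* k ℕ.+ 2

  position : ∀ j r → + (j ℕ.* m ℕ.+ r) ≡ + j * + m + + r
  position j r = cong (_+ + r) (ℤ.pos-* j m)

  k≤m∸1 : k ℕ.≤ 2 ℕ.* k ℕ.+ 1
  k≤m∸1 = ℕ.≤-trans (ℕ.m≤m+n k (k ℕ.+ 0)) (ℕ.m≤m+n (2 ℕ.* k) 1)

  ≤k⇒<m : ∀ {s} → s ℕ.≤ k → s ℕ.< m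
  ≤k⇒<m s≤k = ℕ.≤-trans (s≤s (ℕ.≤-trans s≤k k≤m∸1)) (ℕ.≤-reflexive (sym (ℕ.+-suc (2 ℕ.* k) 1)))

  rising-exponent : ∀ d {s} → s ℕ.≤ k → d * + m + (+ (2 ℕ.* k ℕ.+ 1) - + s) ≡ d * + m + + (2 ℕ.* k ℕ.+ 1 ℕ.∸ s)
  rising-exponent d {s} s≤k = cong (_+_ (d * + m))
    (trans (ℤ.m-n≡m⊖n (2 ℕ.* k ℕ.+ 1) s) (ℤ.⊖-≥ (ℕ.≤-trans s≤k k≤m∸1)))

  -- The constant 2(k+1)² equals (k+1)m. So the exponents of the second sum have remainder `s`
  -- modulo `m` and a quotient that decreases as `d` grows.
  falling-exponent : ∀ d s → d * - (+ m) + + (2 ℕ.* ((k ℕ.+ 1) ℕ.* (k ℕ.+ 1)) ℕ.+ s) ≡ (+ suc k - d) * + m + + s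
  falling-exponent d s = begin
    d * - (+ m) + + (2 ℕ.* ((k ℕ.+ 1) ℕ.* (k ℕ.+ 1)) ℕ.+ s)  ≡⟨ cong (λ n → d * - (+ m) + + (n ℕ.+ s)) (lemmaℕ k) ⟩
    d * - (+ m) + (+ (suc k ℕ.* m) + + s)                    ≡⟨ cong (λ z → d * - (+ m) + (z + + s)) (ℤ.pos-* (suc k) m) ⟩
    d * - (+ m) + (+ suc k * + m + + s)                      ≡⟨ lemma d (+ m) (+ suc k) (+ s) ⟩
    (+ suc k - d) * + m + + s                                ∎
    where
    open ≡-Reasoning
    lemmaℕ : ∀ k → 2 ℕ.* ((k ℕ.+ 1) ℕ.* (k ℕ.+ 1)) ≡ suc k ℕ.* (2 ℕ.* k ℕ.+ 2)
    lemmaℕ = solveℕ-∀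
    lemma : ∀ d m n s → d * - m + (n * m + s) ≡ (n - d) * m + s
    lemma = solve-∀

  rising-remainder< : ∀ s → 2 ℕ.* k ℕ.+ 1 ℕ.∸ s ℕ.< m
  rising-remainder< s = ℕ.≤-trans (s≤s (ℕ.m∸n≤m (2 ℕ.* k ℕ.+ 1) s)) (ℕ.≤-reflexive (sym (ℕ.+-suc (2 ℕ.* k) 1)))

  rising-remainder : ∀ {s} → s ℕ.≤ k → 2 ℕ.* k ℕ.+ 1 ℕ.∸ s ≡ suc k ℕ.+ (k ℕ.∸ s)
  rising-remainder {s} s≤k = trans (cong (ℕ._∸ s) (lemma k)) (ℕ.+-∸-assoc (suc k) s≤k)
    where
    lemma : ∀ k → 2 ℕ.* k ℕ.+ 1 ≡ suc k ℕ.+ k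
    lemma = solveℕ-∀

  rising falling : ℤ → ℕ → ℤ
  rising e s = U k s (λ d → δ e (d * + m + (+ (2 ℕ.* k ℕ.+ 1) - + s)))
  falling e s = U k s (λ d → δ e (d * - (+ m) + + (2 ℕ.* ((k ℕ.+ 1) ℕ.* (k ℕ.+ 1)) ℕ.+ s)))

  rising-≡0 : ∀ j r s → s ℕ.≤ k → r ℕ.< m → r ≢ suc k ℕ.+ (k ℕ.∸ s) → rising (+ (j ℕ.* m ℕ.+ r)) s ≡ 0ℤ
  rising-≡0 j r s s≤k r<m r≢ = trans
    (U-cong k s λ d → δ-≢ λ eq → r≢ (trans
      (sym (remainder-unique m d (+ j) _ r (rising-remainder< s) r<m
        (trans (sym (rising-exponent d s≤k)) (trans eq (position j r)))))
      (rising-remainder s≤k)))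
    (U-zero k s)

  falling-≡0 : ∀ j r s → s ℕ.≤ k → r ℕ.< m → s ≢ r → falling (+ (j ℕ.* m ℕ.+ r)) s ≡ 0ℤ
  falling-≡0 j r s s≤k r<m s≢r = trans
    (U-cong k s λ d → δ-≢ λ eq → s≢r
      (remainder-unique m (+ suc k - d) (+ j) s r (≤k⇒<m s≤k) r<m
        (trans (sym (falling-exponent d s)) (trans eq (position j r)))))
    (U-zero k s)

  rising-≡u : ∀ j s → s ℕ.≤ k → rising (+ (j ℕ.* m ℕ.+ (suc k ℕ.+ (k ℕ.∸ s)))) s ≡ u k s (+ j)
  rising-≡u j s s≤k = U-cong k s λ d → δ-⇔
    (λ eq → quotient-unique m d (+ j) _ _ (rising-remainder< s) (rising-remainder< s)
      (trans (sym (rising-exponent d s≤k)) (trans eq target)))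
    (λ { refl → trans (rising-exponent (+ j) s≤k) (sym target) })
    where
    target : + (j ℕ.* m ℕ.+ (suc k ℕ.+ (k ℕ.∸ s))) ≡ + j * + m + + (2 ℕ.* k ℕ.+ 1 ℕ.∸ s)
    target = trans (position j _) (cong (λ r → + j * + m + + r) (sym (rising-remainder s≤k)))

  falling-≡u : ∀ j s → s ℕ.≤ k → falling (+ (j ℕ.* m ℕ.+ s)) s ≡ u k s (+ suc k - + j)
  falling-≡u j s s≤k = U-cong k s λ d → δ-⇔
    (λ eq → trans (lemma (+ suc k) d) (cong (_-_ (+ suc k))
      (quotient-unique m (+ suc k - d) (+ j) s s (≤k⇒<m s≤k) (≤k⇒<m s≤k)
        (trans (sym (falling-exponent d s)) (trans eq (position j s))))))
    (λ { refl → trans (falling-exponent (+ suc k - + j) s)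
           (trans (cong (λ z → z * + m + + s) (sym (lemma (+ suc k) (+ j)))) (sym (position j s))) })
    where
    lemma : ∀ n d → d ≡ n - (n - d)
    lemma = solve-∀

  -- Remainders at most `k` occur only in the second sum, and there only for `s = r`.
  coeff-low : ∀ j r → r ℕ.≤ k → coeff (Hk k) (+ (j ℕ.* m ℕ.+ r)) ≡ u k r (+ suc k - + j)
  coeff-low j r r≤k = begin
    coeff (Hk k) e
      ≡⟨ coeff-Hk k e ⟩
    ∑ (upTo (suc k)) (rising e) + ∑ (upTo (suc k)) (falling e)
      ≡⟨ cong₂ _+_
           (∑-upTo-zero (suc k) (rising e) (λ s s<1+k → rising-≡0 j r s (ℕ.≤-pred s<1+k) (≤k⇒<m r≤k)
             (ℕ.<⇒≢ (ℕ.≤-trans (s≤s r≤k) (ℕ.m≤m+n (suc k) (k ℕ.∸ s))))))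
           (∑-upTo-single (suc k) (falling e) r (s≤s r≤k) (λ s s<1+k → falling-≡0 j r s (ℕ.≤-pred s<1+k) (≤k⇒<m r≤k))) ⟩
    0ℤ + falling e r
      ≡⟨ ℤ.+-identityˡ (falling e r) ⟩
    falling e r
      ≡⟨ falling-≡u j r r≤k ⟩
    u k r (+ suc k - + j)
      ∎
    where
    open ≡-Reasoning
    e = + (j ℕ.* m ℕ.+ r)

  -- Remainders from k + 1 to 2k + 1 occur only in the first sum, each for a single `s`.
  coeff-high : ∀ j s → s ℕ.≤ k → coeff (Hk k) (+ (j ℕ.* m ℕ.+ (suc k ℕ.+ (k ℕ.∸ s)))) ≡ u k s (+ j)
  coeff-high j s s≤k = begin
    coeff (Hk k) e
      ≡⟨ coeff-Hk k e ⟩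
    ∑ (upTo (suc k)) (rising e) + ∑ (upTo (suc k)) (falling e)
      ≡⟨ cong₂ _+_
           (∑-upTo-single (suc k) (rising e) s (s≤s s≤k) (λ s′ s′<1+k s′≢s → rising-≡0 j r s′ (ℕ.≤-pred s′<1+k) r<m
             (λ eq → s′≢s (ℕ.∸-cancelˡ-≡ (ℕ.≤-pred s′<1+k) s≤k (sym (ℕ.+-cancelˡ-≡ (suc k) _ _ eq))))))
           (∑-upTo-zero (suc k) (falling e) (λ s′ s′<1+k → falling-≡0 j r s′ (ℕ.≤-pred s′<1+k) r<m
             (ℕ.<⇒≢ (ℕ.≤-trans s′<1+k (ℕ.m≤m+n (suc k) (k ℕ.∸ s)))))) ⟩
    rising e s + 0ℤ
      ≡⟨ ℤ.+-identityʳ (rising e s) ⟩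
    rising e s
      ≡⟨ rising-≡u j s s≤k ⟩
    u k s (+ j)
      ∎
    where
    open ≡-Reasoning
    r = suc k ℕ.+ (k ℕ.∸ s)
    r<m : r ℕ.< m
    r<m = subst (ℕ._< m) (rising-remainder s≤k) (rising-remainder< s)
    e = + (j ℕ.* m ℕ.+ r)

-- Monotonicity

u-suc : ∀ k s j → s ℕ.≤ k → u (suc k) (suc s) j ≡ u (suc k) s j + (u k s (j - 1ℤ) - u k s j)
u-suc k s j s≤k = trans (U-suc k s (δ j) s≤k) (cong (λ z → u (suc k) s j + (z - u k s j))
  (U-cong k s λ d → δ-⇔ (λ eq → trans (lemma₁ d) (cong (_- 1ℤ) eq)) (λ { refl → lemma₂ j })))
  where
  lemma₁ : ∀ d → d ≡ (1ℤ + d) - 1ℤ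
  lemma₁ = solve-∀
  lemma₂ : ∀ j → 1ℤ + (j - 1ℤ) ≡ j
  lemma₂ = solve-∀

u-sym-first : ∀ k j → u k 0 j ≡ u k 0 (+ k - j)
u-sym-first k j = begin
  U k 0 (δ j)                      ≡⟨ U₀≡V₀ k (δ j) ⟩
  V k 0 (δ j)                      ≡⟨ V-reflect k 0 (δ j) ⟩
  U k 0 (λ d → δ j (+ k - d))      ≡⟨ U-cong k 0 (λ d → δ-⇔ (λ { refl → lemma (+ k) d }) (λ { refl → sym (lemma (+ k) j) })) ⟩
  U k 0 (δ (+ k - j))              ∎
  where
  open ≡-Reasoning
  lemma : ∀ n d → d ≡ n - (n - d)
  lemma = solve-∀

u-sym-last : ∀ k j → u (suc k) (suc k) j ≡ u (suc k) (suc k) (+ suc (suc k) - j)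
u-sym-last k j = begin
  U (suc k) (suc k) (δ j)                                    ≡⟨ Uₙ≡Vₙ∘suc k (δ j) ⟩
  V (suc k) (suc k) (δ j ∘ ℤ.suc)                            ≡⟨ V-reflect (suc k) (suc k) (δ j ∘ ℤ.suc) ⟩
  U (suc k) (suc k) (λ d → δ j (ℤ.suc (+ suc k - d)))        ≡⟨ U-cong (suc k) (suc k) (λ d → δ-⇔
                                                                  (λ { refl → lemma (+ suc k) d })
                                                                  (λ { refl → lemma′ (+ suc k) j })) ⟩
  U (suc k) (suc k) (δ (+ suc (suc k) - j))                  ∎
  where
  open ≡-Reasoning
  lemma : ∀ n d → d ≡ (1ℤ + n) - (1ℤ + (n - d))
  lemma = solve-∀
  lemma′ : ∀ n j → 1ℤ + (n - ((1ℤ + n) - j)) ≡ j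
  lemma′ = solve-∀

-- Reduces a linear inequality to a known one plus a ring identity; `n` is the slack between them.
≤-by-difference : ∀ n {a b c d} → d - c ≡ (b - a) + + n → a ≤ b → c ≤ d
≤-by-difference n eq a≤b = ℤ.0≤i-j⇒j≤i
  (subst (0ℤ ≤_) (sym eq) (ℤ.+-mono-≤ (ℤ.i≤j⇒0≤j-i a≤b) (ℤ.+≤+ z≤n)))

-- Monotonicity in `j` at fixed `s`. The two ranges are complementary, and bounding 2j avoids a
-- distinction by the parity of `k`.
Rises Falls : ℕ → Set
Rises k = ∀ s j → s ℕ.≤ k → + 2 * j ≤ 1ℤ + + k → u k s (j - 1ℤ) ≤ u k s j
Falls k = ∀ s j → s ℕ.≤ k → + 2 + + k ≤ + 2 * j → u k s j ≤ u k s (j - 1ℤ)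

-- Monotonicity in `s` at fixed `j`, that is, along a block; again the two ranges are complementary.
Descends Ascends : ℕ → Set
Descends k = ∀ {s t} j → s ℕ.≤ t → t ℕ.≤ k → + 2 * j ≤ + k → u k t j ≤ u k s j
Ascends k = ∀ {s t} j → s ℕ.≤ t → t ℕ.≤ k → 1ℤ + + k ≤ + 2 * j → u k s j ≤ u k t j

antitone-chain : ∀ n (f : ℕ → ℤ) → (∀ s → s ℕ.< n → f (suc s) ≤ f s) →
                 ∀ {s t} → s ℕ.≤ t → t ℕ.≤ n → f t ≤ f s
antitone-chain n f step {s} s≤t t≤n = go (ℕ.≤⇒≤′ s≤t) t≤n
  where
  go : ∀ {t} → s ℕ.≤′ t → t ℕ.≤ n → f t ≤ f s
  go ℕ.≤′-refl       t≤n = ℤ.≤-refl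
  go (ℕ.≤′-step s≤t) t<n = ℤ.≤-trans (step _ t<n) (go s≤t (ℕ.<⇒≤ t<n))

monotone-chain : ∀ n (f : ℕ → ℤ) → (∀ s → s ℕ.< n → f s ≤ f (suc s)) →
                 ∀ {s t} → s ℕ.≤ t → t ℕ.≤ n → f s ≤ f t
monotone-chain n f step {s} s≤t t≤n = go (ℕ.≤⇒≤′ s≤t) t≤n
  where
  go : ∀ {t} → s ℕ.≤′ t → t ℕ.≤ n → f s ≤ f t
  go ℕ.≤′-refl       t≤n = ℤ.≤-refl
  go (ℕ.≤′-step s≤t) t<n = ℤ.≤-trans (go s≤t (ℕ.<⇒≤ t<n)) (step _ t<n)

-- By `u-suc`, passing from `s` to `s + 1` at level k + 1 adds the difference of the level k
-- coefficients at j - 1 and j, which `Rises k` makes nonpositive. The bounds on `j` are the same at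
-- both levels.
rises⇒descends : ∀ {k} → Rises k → Descends (suc k)
rises⇒descends {k} rises j s≤t t≤k 2j≤k = antitone-chain (suc k) (λ s → u (suc k) s j) step s≤t t≤k
  where
  step : ∀ s → s ℕ.< suc k → u (suc k) (suc s) j ≤ u (suc k) s j
  step s (s≤s s≤k) = ≤-by-difference 0
    (trans (cong (_-_ (u (suc k) s j)) (u-suc k s j s≤k)) (lemma (u (suc k) s j) (u k s (j - 1ℤ)) (u k s j)))
    (rises s j s≤k 2j≤k)
    where
    lemma : ∀ a b c → a - (a + (b - c)) ≡ (c - b) + 0ℤ
    lemma = solve-∀

falls⇒ascends : ∀ {k} → Falls k → Ascends (suc k)
falls⇒ascends {k} falls j s≤t t≤k k<2j = monotone-chain (suc k) (λ s → u (suc k) s j) step s≤t t≤k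
  where
  step : ∀ s → s ℕ.< suc k → u (suc k) s j ≤ u (suc k) (suc s) j
  step s (s≤s s≤k) = ≤-by-difference 0
    (trans (cong (_- u (suc k) s j) (u-suc k s j s≤k)) (lemma (u (suc k) s j) (u k s (j - 1ℤ)) (u k s j)))
    (falls s j s≤k k<2j)
    where
    lemma : ∀ a b c → (a + (b - c)) - a ≡ (b - c) + 0ℤ
    lemma = solve-∀

-- Walks around the symmetric blocks from (s , j - 1) to (s , j), or back.
module Reflection (k : ℕ) (descends : Descends (suc k)) (ascends : Ascends (suc k)) where

  private
    n : ℕ
    n = suc k

    n+1-j : ℤ → ℤ
    n+1-j j = + n - (j - 1ℤ)

    sym-last : ∀ j → u n n (n+1-j j) ≡ u n n j
    sym-last j = trans (u-sym-last k (n+1-j j)) (cong (u n n) (lemma (+ n) j))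
      where
      lemma : ∀ n j → (1ℤ + n) - (n - (j - 1ℤ)) ≡ j
      lemma = solve-∀

  rises : Rises n
  rises s j s≤n 2j≤n+1 = begin
    u n s (j - 1ℤ)    ≤⟨ descends (j - 1ℤ) z≤n s≤n (≤-by-difference 1 (lemma₁ (+ n) j) 2j≤n+1) ⟩
    u n 0 (j - 1ℤ)    ≡⟨ u-sym-first n (j - 1ℤ) ⟩
    u n 0 (n+1-j j)   ≤⟨ rest (+ 2 * j ℤ.≤? + n) ⟩
    u n s j           ∎
    where
    open ℤ.≤-Reasoning
    lemma₁ : ∀ n j → n - + 2 * (j - 1ℤ) ≡ ((1ℤ + n) - + 2 * j) + 1ℤ
    lemma₁ = solve-∀
    lemma₂ : ∀ n j → + 2 * (n - (j - 1ℤ)) - (1ℤ + n) ≡ ((1ℤ + n) - + 2 * j) + 0ℤ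
    lemma₂ = solve-∀
    lemma₃ : ∀ n j → (1ℤ + n) - j ≡ n - (j - 1ℤ)
    lemma₃ = solve-∀
    double : ∀ j → + 2 * j - j ≡ j
    double = solve-∀
    high : 1ℤ + + n ≤ + 2 * n+1-j j
    high = ≤-by-difference 0 (lemma₂ (+ n) j) 2j≤n+1
    rest : Dec (+ 2 * j ≤ + n) → u n 0 (n+1-j j) ≤ u n s j
    rest (yes 2j≤n) = begin
      u n 0 (n+1-j j)  ≤⟨ ascends (n+1-j j) z≤n ℕ.≤-refl high ⟩
      u n n (n+1-j j)  ≡⟨ sym-last j ⟩
      u n n j          ≤⟨ descends j s≤n ℕ.≤-refl 2j≤n ⟩
      u n s j          ∎
    -- Now 2j = n + 1, just outside the range of `descends`; but then the reflected index n - (j -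
    -- 1) is j itself, so the walk can stop at `s`.
    rest (no 2j≰n) = begin
      u n 0 (n+1-j j)  ≤⟨ ascends (n+1-j j) z≤n s≤n high ⟩
      u n s (n+1-j j)  ≡⟨ cong (u n s) (trans (sym (lemma₃ (+ n) j)) (trans (cong (_- j) (sym 2j≡n+1)) (double j))) ⟩
      u n s j          ∎
      where
      2j≡n+1 : + 2 * j ≡ 1ℤ + + n
      2j≡n+1 = ℤ.≤-antisym 2j≤n+1 (ℤ.i<j⇒suc[i]≤j (ℤ.≰⇒> 2j≰n))

  falls : Falls n
  falls s j s≤n n+2≤2j = begin
    u n s j           ≤⟨ ascends j s≤n ℕ.≤-refl (≤-by-difference 1 (lemma₁ (+ n) j) n+2≤2j) ⟩
    u n n j           ≡⟨ sym-last j ⟨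
    u n n (n+1-j j)   ≤⟨ rest (1ℤ + + n ℤ.≤? + 2 * (j - 1ℤ)) ⟩
    u n s (j - 1ℤ)    ∎
    where
    open ℤ.≤-Reasoning
    lemma₁ : ∀ n j → + 2 * j - (1ℤ + n) ≡ (+ 2 * j - (+ 2 + n)) + 1ℤ
    lemma₁ = solve-∀
    lemma₂ : ∀ n j → n - + 2 * (n - (j - 1ℤ)) ≡ (+ 2 * j - (+ 2 + n)) + 0ℤ
    lemma₂ = solve-∀
    lemma₃ : ∀ n j → + 2 * (j - 1ℤ) - n ≡ (+ 2 * j - (+ 2 + n)) + 0ℤ
    lemma₃ = solve-∀
    double : ∀ j → + 2 * (j - 1ℤ) - (j - 1ℤ) ≡ j - 1ℤ
    double = solve-∀
    low : + 2 * n+1-j j ≤ + n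
    low = ≤-by-difference 0 (lemma₂ (+ n) j) n+2≤2j
    rest : Dec (1ℤ + + n ≤ + 2 * (j - 1ℤ)) → u n n (n+1-j j) ≤ u n s (j - 1ℤ)
    rest (yes n+1≤2[j-1]) = begin
      u n n (n+1-j j)  ≤⟨ descends (n+1-j j) z≤n ℕ.≤-refl low ⟩
      u n 0 (n+1-j j)  ≡⟨ u-sym-first n (j - 1ℤ) ⟨
      u n 0 (j - 1ℤ)   ≤⟨ ascends (j - 1ℤ) z≤n s≤n n+1≤2[j-1] ⟩
      u n s (j - 1ℤ)   ∎
    -- Now 2(j - 1) = n, just outside the range of `ascends`; the reflected index n - (j - 1) is
    -- then j - 1 itself.
    rest (no n+1≰2[j-1]) = begin
      u n n (n+1-j j)  ≤⟨ descends (n+1-j j) s≤n ℕ.≤-refl low ⟩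
      u n s (n+1-j j)  ≡⟨ cong (u n s) (trans (cong (_- (j - 1ℤ)) (sym 2[j-1]≡n)) (double j)) ⟩
      u n s (j - 1ℤ)   ∎
      where
      2[j-1]≡n : + 2 * (j - 1ℤ) ≡ + n
      2[j-1]≡n = ℤ.≤-antisym
        (≤-by-difference 0 (lemma₅ (+ n) j) (ℤ.i<j⇒suc[i]≤j (ℤ.≰⇒> n+1≰2[j-1])))
        (≤-by-difference 0 (lemma₃ (+ n) j) n+2≤2j)
        where
        lemma₅ : ∀ n j → n - + 2 * (j - 1ℤ) ≡ ((1ℤ + n) - (1ℤ + + 2 * (j - 1ℤ))) + 0ℤ
        lemma₅ = solve-∀

rises∧falls : ∀ k → Rises k × Falls k
rises∧falls zero = rises₀ , falls₀
  where
  2≰1 : ¬ + 2 ≤ 1ℤ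
  2≰1 (ℤ.+≤+ (s≤s ()))
  2≰0 : ¬ + 2 ≤ 0ℤ
  2≰0 (ℤ.+≤+ ())
  rises₀ : Rises 0
  -- At level 0 the only nonzero coefficient sits at 0, and 2j ≤ 1 excludes j = 1. For `falls₀` the
  -- bound 2 ≤ 2j excludes j = 0.
  rises₀ s j _ 2j≤1 = subst (_≤ δ j 0ℤ) (sym (δ-≢ 0≢j-1)) (δ-nonNeg j 0ℤ)
    where
    0≢j-1 : 0ℤ ≢ j - 1ℤ
    0≢j-1 eq = 2≰1 (subst (λ j → + 2 * j ≤ 1ℤ) (ℤ.i-j≡0⇒i≡j j 1ℤ (sym eq)) 2j≤1)
  falls₀ : Falls 0
  falls₀ s j _ 2≤2j = subst (_≤ δ (j - 1ℤ) 0ℤ) (sym (δ-≢ 0≢j)) (δ-nonNeg (j - 1ℤ) 0ℤ)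
    where
    0≢j : 0ℤ ≢ j
    0≢j eq = 2≰0 (subst (λ j → + 2 ≤ + 2 * j) (sym eq) 2≤2j)
rises∧falls (suc k) with rises , falls ← rises∧falls k = R.rises , R.falls
  where module R = Reflection k (rises⇒descends rises) (falls⇒ascends falls)

-- A lower bound for the degree

u-positive : ∀ n → 1ℤ ≤ u n 0 0ℤ
u-positive zero    = ℤ.≤-refl
-- The positive first letter of rank 0 already contributes 1; repeating this choice spells the
-- identity permutation, which has no descents.
u-positive (suc n) = ℤ.+-mono-≤ {1ℤ} {_} {0ℤ}
  (ℤ.+-mono-≤ {1ℤ} {_} {0ℤ} (u-positive n) (V-nonNeg n 0 (δ-nonNeg 0ℤ ∘ ℤ.suc)))
  (∑-nonNeg (applyUpTo suc n) λ i →
    ℤ.+-mono-≤ (U-nonNeg n i (δ-nonNeg 0ℤ)) (V-nonNeg n i (δ-nonNeg 0ℤ ∘ ℤ.suc)))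

coeff-support : ∀ p {e} → coeff p e ≢ 0ℤ → Any (λ t → proj₂ t ≡ e) p
coeff-support []            c≢0 = ⊥-elim (c≢0 refl)
coeff-support ((c , f) ∷ p) {e} c≢0 with f ℤ.≟ e
... | yes f≡e = here f≡e
... | no _    = there (coeff-support p (c≢0 ∘ trans (ℤ.+-identityˡ (coeff p e))))

-- `degree` ranges over listed monomials, so a nonzero coefficient is first traced to one of them.
-- The helper recurses on `q` while the test for nonzero coefficients keeps referring to all of `p`.
≤-degree : ∀ p {e} → coeff p e ≢ 0ℤ → e ≤ degree p
≤-degree p {e} c≢0 = go p (coeff-support p c≢0)
  where
  go : ∀ q → Any (λ t → proj₂ t ≡ e) q →
    e ≤ foldr (λ { (c , f) acc → if not ⌊ coeff p f ℤ.≟ + 0 ⌋ then f ℤ.⊔ acc else acc }) (+ 0) q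
  go ((c , f) ∷ q) (here refl) with coeff p e ℤ.≟ + 0
  ... | yes c≡0 = ⊥-elim (c≢0 c≡0)
  ... | no _    = ℤ.i≤i⊔j e _
  go ((c , f) ∷ q) (there e∈q) with ⌊ coeff p f ℤ.≟ + 0 ⌋
  ... | true  = go q e∈q
  ... | false = ℤ.≤-trans (go q e∈q) (ℤ.i≤j⊔i f _)

-- Blocks of coefficients and the peak

parity : ∀ q → ∃ λ j → q ≡ 2 ℕ.* j ⊎ q ≡ suc (2 ℕ.* j)
parity zero = 0 , inj₁ refl
parity (suc q) with parity q
... | j , inj₁ refl = j , inj₂ refl
... | j , inj₂ refl = suc j , inj₁ (lemma j)
  where
  lemma : ∀ j → suc (suc (2 ℕ.* j)) ≡ 2 ℕ.* suc j
  lemma = solveℕ-∀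

-- This treats `Hk (suc k)`: monotonicity along its blocks comes from level `k`. A block has length
-- `N`, half of the modulus `m`.
module Blocks (k : ℕ) where

  open Position (suc k)

  n N : ℕ
  n = suc k
  N = suc n

  h : ℕ → ℤ
  h e = coeff (Hk n) (+ e)

  h-even : ∀ j {r} → r ℕ.≤ n → h (2 ℕ.* j ℕ.* N ℕ.+ r) ≡ u n r (+ N - + j)
  h-even j {r} r≤n = trans (cong (λ e → h (e ℕ.+ r)) (lemma j n)) (coeff-low j r r≤n)
    where
    lemma : ∀ j n → 2 ℕ.* j ℕ.* suc n ≡ j ℕ.* (2 ℕ.* n ℕ.+ 2)
    lemma = solveℕ-∀

  h-odd : ∀ j {r} → r ℕ.≤ n → h (suc (2 ℕ.* j) ℕ.* N ℕ.+ r) ≡ u n (n ℕ.∸ r) (+ j)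
  h-odd j {r} r≤n = begin
    h (suc (2 ℕ.* j) ℕ.* N ℕ.+ r)                     ≡⟨ cong h (lemma j n r) ⟩
    h (j ℕ.* m ℕ.+ (N ℕ.+ r))                         ≡⟨ cong (λ r → h (j ℕ.* m ℕ.+ (N ℕ.+ r))) (sym (ℕ.m∸[m∸n]≡n r≤n)) ⟩
    h (j ℕ.* m ℕ.+ (N ℕ.+ (n ℕ.∸ (n ℕ.∸ r))))         ≡⟨ coeff-high j (n ℕ.∸ r) (ℕ.m∸n≤m n r) ⟩
    u n (n ℕ.∸ r) (+ j)                               ∎
    where
    open ≡-Reasoning
    lemma : ∀ j n r → suc (2 ℕ.* j) ℕ.* suc n ℕ.+ r ≡ j ℕ.* (2 ℕ.* n ℕ.+ 2) ℕ.+ (suc n ℕ.+ r)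
    lemma = solveℕ-∀

  descends : Descends n
  descends = rises⇒descends (proj₁ (rises∧falls k))

  ascends : Ascends n
  ascends = falls⇒ascends (proj₂ (rises∧falls k))

  -- In an even block q = 2j the index is N - j and `s` increases; 2j ≤ N means 2(N - j) ≥ n + 1,
  -- the range of `ascends`. In an odd block q = 2j + 1 the index is j and `s` decreases; 2j ≤ n is
  -- the range of `descends`.
  within-up : ∀ q r → r ℕ.< n → q ℕ.≤ N → h (q ℕ.* N ℕ.+ r) ≤ h (q ℕ.* N ℕ.+ suc r)
  within-up q r r<n q≤N with parity q
  ... | j , inj₁ refl = subst₂ _≤_ (sym (h-even j (ℕ.<⇒≤ r<n))) (sym (h-even j r<n))
    (ascends (+ N - + j) (ℕ.n≤1+n r) r<n
      (≤-by-difference 0 (lemma (+ n) (+ j)) (subst (_≤ + N) (ℤ.pos-* 2 j) (ℤ.+≤+ q≤N))))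
    where
    lemma : ∀ n j → + 2 * ((1ℤ + n) - j) - (1ℤ + n) ≡ ((1ℤ + n) - + 2 * j) + 0ℤ
    lemma = solve-∀
  ... | j , inj₂ refl = subst₂ _≤_ (sym (h-odd j (ℕ.<⇒≤ r<n))) (sym (h-odd j r<n))
    (descends (+ j) (ℕ.∸-monoʳ-≤ n (ℕ.n≤1+n r)) (ℕ.m∸n≤m n r)
      (subst (_≤ + n) (ℤ.pos-* 2 j) (ℤ.+≤+ (ℕ.≤-pred q≤N))))

  -- Past block `N` the indices lie in the complementary ranges, so `ascends` and `descends` trade
  -- places.
  within-down : ∀ q r → r ℕ.< n → N ℕ.< q → h (q ℕ.* N ℕ.+ suc r) ≤ h (q ℕ.* N ℕ.+ r)
  within-down q r r<n N<q with parity q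
  ... | j , inj₁ refl = subst₂ _≤_ (sym (h-even j r<n)) (sym (h-even j (ℕ.<⇒≤ r<n)))
    (descends (+ N - + j) (ℕ.n≤1+n r) r<n
      (≤-by-difference 0 (lemma (+ n) (+ j)) (subst (+ suc N ≤_) (ℤ.pos-* 2 j) (ℤ.+≤+ N<q))))
    where
    lemma : ∀ n j → n - + 2 * ((1ℤ + n) - j) ≡ (+ 2 * j - (+ 2 + n)) + 0ℤ
    lemma = solve-∀
  ... | j , inj₂ refl = subst₂ _≤_ (sym (h-odd j r<n)) (sym (h-odd j (ℕ.<⇒≤ r<n)))
    (ascends (+ j) (ℕ.∸-monoʳ-≤ n (ℕ.n≤1+n r)) (ℕ.m∸n≤m n r)
      (subst (+ N ≤_) (ℤ.pos-* 2 j) (ℤ.+≤+ (ℕ.≤-pred N<q))))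

  -- An even block meets the next odd one at `s = n`, an odd block meets the next even one at
  -- `s = 0`; the symmetry at that value of `s` identifies the two coefficients.
  across : ∀ q → h (q ℕ.* N ℕ.+ n) ≡ h (suc q ℕ.* N ℕ.+ 0)
  across q with parity q
  ... | j , inj₁ refl = begin
    h (2 ℕ.* j ℕ.* N ℕ.+ n)            ≡⟨ h-even j ℕ.≤-refl ⟩
    u n n (+ N - + j)                  ≡⟨ u-sym-last k (+ N - + j) ⟩
    u n n (+ N - (+ N - + j))          ≡⟨ cong (u n n) (lemma (+ N) (+ j)) ⟩
    u n n (+ j)                        ≡⟨ h-odd j z≤n ⟨
    h (suc (2 ℕ.* j) ℕ.* N ℕ.+ 0)      ∎
    where
    open ≡-Reasoning
    lemma : ∀ n j → n - (n - j) ≡ j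
    lemma = solve-∀
  ... | j , inj₂ refl = begin
    h (suc (2 ℕ.* j) ℕ.* N ℕ.+ n)      ≡⟨ h-odd j ℕ.≤-refl ⟩
    u n (n ℕ.∸ n) (+ j)                ≡⟨ cong (λ s → u n s (+ j)) (ℕ.n∸n≡0 n) ⟩
    u n 0 (+ j)                        ≡⟨ u-sym-first n (+ j) ⟩
    u n 0 (+ n - + j)                  ≡⟨ cong (u n 0) (lemma (+ n) (+ j)) ⟩
    u n 0 (+ N - + suc j)              ≡⟨ h-even (suc j) z≤n ⟨
    h (2 ℕ.* suc j ℕ.* N ℕ.+ 0)        ≡⟨ cong (λ q → h (q ℕ.* N ℕ.+ 0)) (lemmaℕ j) ⟩
    h (suc (suc (2 ℕ.* j)) ℕ.* N ℕ.+ 0)  ∎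
    where
    open ≡-Reasoning
    lemma : ∀ n j → n - j ≡ (1ℤ + n) - (1ℤ + j)
    lemma = solve-∀
    lemmaℕ : ∀ j → 2 ℕ.* suc j ≡ suc (suc (2 ℕ.* j))
    lemmaℕ = solveℕ-∀

  -- The last exponent of block `N`: coefficients rise weakly through the blocks 0, ..., N and fall
  -- weakly afterwards.
  peak : ℕ
  peak = N ℕ.* N ℕ.+ n

  block-end : ∀ q → suc (q ℕ.* N ℕ.+ n) ≡ suc q ℕ.* N ℕ.+ 0
  block-end q = lemma q n
    where
    lemma : ∀ q n → suc (q ℕ.* suc n ℕ.+ n) ≡ suc q ℕ.* suc n ℕ.+ 0
    lemma = solveℕ-∀

  before-peak : ∀ q r → q ℕ.* N ℕ.+ r ℕ.< peak → q ℕ.≤ N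
  before-peak q r e<peak = ℕ.≮⇒≥ λ N<q → ℕ.<-irrefl refl (begin-strict
    q ℕ.* N ℕ.+ r    <⟨ e<peak ⟩
    peak             <⟨ ℕ.≤-reflexive (trans (block-end N) (ℕ.+-identityʳ _)) ⟩
    suc N ℕ.* N      ≤⟨ ℕ.*-monoˡ-≤ N N<q ⟩
    q ℕ.* N          ≤⟨ ℕ.m≤m+n (q ℕ.* N) r ⟩
    q ℕ.* N ℕ.+ r    ∎)
    where open ℕ.≤-Reasoning

  after-peak : ∀ q r → r ℕ.< n → peak ℕ.≤ q ℕ.* N ℕ.+ r → N ℕ.< q
  after-peak q r r<n peak≤e = ℕ.≰⇒> λ q≤N → ℕ.<⇒≱ (ℕ.+-mono-≤-< (ℕ.*-monoˡ-≤ N q≤N) r<n) peak≤e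

  record Located (e : ℕ) : Set where
    constructor located
    field
      q r : ℕ
      r≤n : r ℕ.≤ n
      e≡  : e ≡ q ℕ.* N ℕ.+ r

  locate : ∀ e → Located e
  locate e = located (e / N) (e % N) (ℕ.≤-pred (m%n<n e N))
    (trans (m≡m%n+[m/n]*n e N) (ℕ.+-comm (e % N) _))

  up : ∀ e → e ℕ.< peak → h e ≤ h (suc e)
  up e e<peak with locate e
  ... | located q r r≤n refl with ℕ.m≤n⇒m<n∨m≡n r≤n
  -- Either the next exponent lies in the same block, or it begins the next block and carries the
  -- same coefficient.
  ...   | inj₁ r<n  = subst (λ e → h (q ℕ.* N ℕ.+ r) ≤ h e) (ℕ.+-suc (q ℕ.* N) r)
                        (within-up q r r<n (before-peak q r e<peak))
  ...   | inj₂ refl = ℤ.≤-reflexive (trans (across q) (cong h (sym (block-end q))))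

  down : ∀ e → peak ℕ.≤ e → h (suc e) ≤ h e
  down e peak≤e with locate e
  ... | located q r r≤n refl with ℕ.m≤n⇒m<n∨m≡n r≤n
  ...   | inj₁ r<n  = subst (λ e → h e ≤ h (q ℕ.* N ℕ.+ r)) (ℕ.+-suc (q ℕ.* N) r)
                        (within-down q r r<n (after-peak q r r<n peak≤e))
  ...   | inj₂ refl = ℤ.≤-reflexive (trans (cong h (block-end q)) (sym (across q)))

  -- The first exponent of block 2N. Its coefficient is the constant term of `U n 0`, which is
  -- positive, so the degree is at least `top`.
  top : ℕ
  top = 2 ℕ.* N ℕ.* N ℕ.+ 0

  h-top≢0 : h top ≢ 0ℤ
  h-top≢0 h≡0 = 1≰0 (subst (1ℤ ≤_) (trans (sym h-top) h≡0) (u-positive n))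
    where
    1≰0 : ¬ 1ℤ ≤ 0ℤ
    1≰0 (ℤ.+≤+ ())
    h-top : h top ≡ u n 0 0ℤ
    h-top = trans (h-even N z≤n) (cong (u n 0) (ℤ.+-inverseʳ (+ N)))

  peak≤top : peak ℕ.≤ top
  peak≤top = begin
    N ℕ.* N ℕ.+ n        ≤⟨ ℕ.+-monoʳ-≤ (N ℕ.* N) (ℕ.≤-trans (ℕ.n≤1+n n) (ℕ.m≤m*n N N)) ⟩
    N ℕ.* N ℕ.+ N ℕ.* N  ≡⟨ lemma N ⟩
    top                  ∎
    where
    open ℕ.≤-Reasoning
    lemma : ∀ N → N ℕ.* N ℕ.+ N ℕ.* N ≡ 2 ℕ.* N ℕ.* N ℕ.+ 0
    lemma = solveℕ-∀

  unimodal : Unimodal (Hk n)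
  unimodal = peak
    , ℤ.≤-trans (ℤ.+≤+ peak≤top) (≤-degree (Hk n) h-top≢0)
    , (λ i j i≤j j≤peak → monotone-chain peak h up i≤j j≤peak)
    -- The chain lemma starts at 0, hence is applied to the sequence shifted by `peak`.
    , (λ i j peak≤i i≤j _ → subst₂ (λ a b → h a ≤ h b)
        (ℕ.m+[n∸m]≡n (ℕ.≤-trans peak≤i i≤j)) (ℕ.m+[n∸m]≡n peak≤i)
        (antitone-chain (j ℕ.∸ peak) (λ d → h (peak ℕ.+ d))
          (λ d _ → subst (λ e → h e ≤ h (peak ℕ.+ d)) (sym (ℕ.+-suc peak d)) (down (peak ℕ.+ d) (ℕ.m≤m+n peak d)))
          (ℕ.∸-monoˡ-≤ peak i≤j) ℕ.≤-refl))

theorem3p4 : (k : ℕ) → Unimodal (Hk k)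
theorem3p4 (suc k) = Blocks.unimodal k
-- Here the polynomial is x + x², so its coefficients up to degree 2 are compared by computation.
theorem3p4 zero    = 1 , ℤ.+≤+ (s≤s z≤n) , increasing , decreasing
  where
  increasing : ∀ i j → i ℕ.≤ j → j ℕ.≤ 1 → coeff (Hk 0) (+ i) ≤ coeff (Hk 0) (+ j)
  increasing zero       zero       _ _ = ℤ.≤-refl
  increasing zero       (suc zero) _ _ = ℤ.+≤+ z≤n
  increasing (suc zero) (suc zero) _ _ = ℤ.≤-refl
  increasing (suc (suc _)) (suc zero) (s≤s ()) _
  increasing _ (suc (suc _)) _ (s≤s ())
  decreasing : ∀ i j → 1 ℕ.≤ i → i ℕ.≤ j → + j ≤ + 2 → coeff (Hk 0) (+ j) ≤ coeff (Hk 0) (+ i)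
  decreasing (suc zero)       (suc zero)       _ _ _ = ℤ.≤-refl
  decreasing (suc zero)       (suc (suc zero)) _ _ _ = ℤ.≤-refl
  decreasing (suc (suc zero)) (suc (suc zero)) _ _ _ = ℤ.≤-refl
  decreasing (suc (suc _)) (suc zero) _ (s≤s ()) _
  decreasing (suc (suc (suc _))) (suc (suc zero)) _ (s≤s (s≤s ())) _
  decreasing _ (suc (suc (suc _))) _ _ (ℤ.+≤+ (s≤s (s≤s ())))
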